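{- Let $G$ and $H$ be connected graphs, each with more than one vertex, of orders $n$ and $m$ respectively. Suppose $G$ is just a frame graph in the spaces of dimension $n',n'+1,\dots,n-1,n$ and $H$ is just a frame graph in the spaces of dimension $m',m'+1,\dots,m-1,m$, where $n'\ge m'$. Then: (i) the join $G\vee H$ is just a frame graph in the spaces of dimension $n',n'+1,\dots,m+n-1,m+n$; (ii) $G.H$, the graph obtained by joining $G$ and $H$ at a single common vertex, is just a frame graph in the spaces of dimension $n'+m',n'+m'+1,\dots,m+n-2,m+n-1$.
   Context: All graphs are finite and simple. A finite frame for a finite-dimensional inner product space $\mathcal{H}$ over $\mathbb{R}$ or $\mathbb{C}$ is a finite sequence $\varphi=(f_i)_{i=1}^N$ in $\mathcal{H}$ for which there are constants $0<A\le B<\infty$ with $A\|f\|^2\le\sum_{i=1}^N|\langle f,f_i\rangle|^2\le B\|f\|^2$ for all $f\in\mathcal{H}$ (equivalently, a finite sequence spanning $\mathcal{H}$; repeated vectors are allowed and count as different vertices). Its frame graph $G(\varphi)$ has the elements $f_1,\dots,f_N$ of the sequence as vertices, and for $i\ne j$, $f_i$ and $f_j$ are adjacent iff $\langle f_i,f_j\rangle\ne 0$. A graph $G$ is a frame graph in $\mathcal{H}$ if there is a finite frame $\varphi$ for $\mathcal{H}$ with $G(\varphi)=G$ (up to labelling of vertices). "$G$ is just a frame graph in the spaces of dimension $a,a+1,\dots,b$" means: for each $\mathbb{F}\in\{\mathbb{R},\mathbb{C}\}$ and each integer $d\ge1$, $G$ is a frame graph in a $d$-dimensional inner product space over $\mathbb{F}$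 if and only if $a\le d\le b$. The join $G_1\vee G_2$ of vertex-disjoint graphs $G_1=(V_1,E_1)$, $G_2=(V_2,E_2)$ has vertex set $V_1\cup V_2$ and edge set $E_1\cup E_2$ together with all edges joining a vertex of $V_1$ to a vertex of $V_2$. The graph $G_1.G_2$ is a graph that is the union of (copies of) $G_1$ and $G_2$ sharing exactly one vertex $v$, with no edges between a vertex of $V_1\setminus\{v\}$ and a vertex of $V_2\setminus\{v\}$; the choice of the vertex of $G_1$ and the vertex of $G_2$ that are identified is arbitrary. -}

module Defs where

open import Algebra.Bundles using (AbelianGroup; CommutativeRing)
open import Algebra.Construct.DirectProduct using (abelianGroup)
open import Algebra.Core using (Op₂)
open import Algebra.Module.Bundles using (LeftModule)
import Algebra.Definitions.RawMonoid as RawMonoidSum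
import Algebra.Solver.Ring.NaturalCoefficients.Default as SemiringSolver
import Algebra.Properties.Ring as RingProperties
open import Data.Fin.Base using (Fin; splitAt; punchIn)
import Data.Fin.Properties as Fin
open import Data.Nat.Base using (ℕ; suc; pred; _+_; _≤_)
open import Data.Product.Base using (Σ-syntax; ∃-syntax; _×_; _,_; proj₁)
open import Data.Product.Relation.Binary.Pointwise.NonDependent using (×-decidable)
open import Data.Sum.Base using (_⊎_; inj₁; inj₂)
import Data.Sum.Base as Sum
open import Data.Unit.Base using (⊤; tt)
open import Function.Base using (_on_; id)
open import Function.Bundles using (_↔_; _⇔_; module Inverse)
open import Level using (0ℓ) renaming (suc to lsuc)
open import Relation.Binary.Construct.Closure.ReflexiveTransitive using (Star)
open import Relation.Binary.Core using (Rel)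
open import Relation.Binary.Definitions using (Decidable; Symmetric; Irreflexive)
open import Relation.Binary.PropositionalEquality using (_≡_; _≢_)
import Relation.Binary.PropositionalEquality as ≡
open import Relation.Binary.Structures using (IsDecTotalOrder)
open import Relation.Nullary using (¬_; yes; no; ¬?; _×-dec_)
open import Relation.Unary using (Pred)
import Relation.Binary.Reasoning.Setoid as SetoidReasoning

------------------------------------------------------------------------
-- Graphs

record Graph (n : ℕ) : Set₁ where
  field
    Adj    : Rel (Fin n) 0ℓ
    adj?   : Decidable Adj
    symm   : Symmetric Adj
    irrefl : Irreflexive _≡_ Adj

Connected : ∀ {n} → Graph n → Set
Connected G = ∀ i j → Star (Graph.Adj G) i j

infix 4 _≅_

_≅_ : ∀ {n m} → Graph n → Graph m → Set
_≅_ {n} {m} G H = Σ[ σ ∈ Fin n ↔ Fin m ] (∀ i j →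
  Graph.Adj G i j ⇔ Graph.Adj H (Inverse.to σ i) (Inverse.to σ j))

module _ {n m : ℕ} (G : Graph n) (H : Graph m) where
  private
    module G = Graph G
    module H = Graph H

  JoinAdj : Rel (Fin n ⊎ Fin m) 0ℓ
  JoinAdj (inj₁ a) (inj₁ b) = G.Adj a b
  JoinAdj (inj₁ a) (inj₂ y) = ⊤
  JoinAdj (inj₂ x) (inj₁ b) = ⊤
  JoinAdj (inj₂ x) (inj₂ y) = H.Adj x y

  -- The vertex v of G also plays the role of the vertex w of H, so the H-edges
  -- at w reappear at v.  Only used on arguments other than inj₂ w.
  GlueAdj : Fin n → Fin m → Rel (Fin n ⊎ Fin m) 0ℓ
  GlueAdj v w (inj₁ a) (inj₁ b) = G.Adj a b
  GlueAdj v w (inj₁ a) (inj₂ y) = a ≡ v × H.Adj w y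
  GlueAdj v w (inj₂ x) (inj₁ b) = b ≡ v × H.Adj x w
  GlueAdj v w (inj₂ x) (inj₂ y) = H.Adj x y

  private
    joinAdj? : Decidable JoinAdj
    joinAdj? (inj₁ a) (inj₁ b) = G.adj? a b
    joinAdj? (inj₁ a) (inj₂ y) = yes tt
    joinAdj? (inj₂ x) (inj₁ b) = yes tt
    joinAdj? (inj₂ x) (inj₂ y) = H.adj? x y

    joinAdj-symm : Symmetric JoinAdj
    joinAdj-symm {inj₁ a} {inj₁ b} e = G.symm e
    joinAdj-symm {inj₁ a} {inj₂ y} e = tt
    joinAdj-symm {inj₂ x} {inj₁ b} e = tt
    joinAdj-symm {inj₂ x} {inj₂ y} e = H.symm e

    joinAdj-irrefl : ∀ p → ¬ JoinAdj p p
    joinAdj-irrefl (inj₁ a) = G.irrefl ≡.refl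
    joinAdj-irrefl (inj₂ x) = H.irrefl ≡.refl

  module _ (v : Fin n) (w : Fin m) where
    glueAdj? : Decidable (GlueAdj v w)
    glueAdj? (inj₁ a) (inj₁ b) = G.adj? a b
    glueAdj? (inj₁ a) (inj₂ y) = (a Fin.≟ v) ×-dec H.adj? w y
    glueAdj? (inj₂ x) (inj₁ b) = (b Fin.≟ v) ×-dec H.adj? x w
    glueAdj? (inj₂ x) (inj₂ y) = H.adj? x y

    glueAdj-symm : Symmetric (GlueAdj v w)
    glueAdj-symm {inj₁ a} {inj₁ b} e       = G.symm e
    glueAdj-symm {inj₁ a} {inj₂ y} (p , e) = p , H.symm e
    glueAdj-symm {inj₂ x} {inj₁ b} (p , e) = p , H.symm e
    glueAdj-symm {inj₂ x} {inj₂ y} e       = H.symm e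

    glueAdj-irrefl : ∀ p → ¬ GlueAdj v w p p
    glueAdj-irrefl (inj₁ a) = G.irrefl ≡.refl
    glueAdj-irrefl (inj₂ x) = H.irrefl ≡.refl

  infixr 6 _∨_

  _∨_ : Graph (n + m)
  _∨_ = record
    { Adj    = JoinAdj on splitAt n
    ; adj?   = λ i j → joinAdj? (splitAt n i) (splitAt n j)
    ; symm   = λ {i} {j} → joinAdj-symm {splitAt n i} {splitAt n j}
    ; irrefl = λ { {i} ≡.refl → joinAdj-irrefl (splitAt n i) }
    }

-- G.H, with the vertex v of G and the vertex w of H identified.  The vertices
-- n , n + 1 , … are the vertices of H other than w, enumerated by punchIn w.
glue : ∀ {n m} (G : Graph n) (H : Graph m) → Fin n → Fin m → Graph (n + pred m)
glue {n} {suc k} G H v w = record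
  { Adj    = GlueAdj G H v w on vertex
  ; adj?   = λ i j → glueAdj? G H v w (vertex i) (vertex j)
  ; symm   = λ {i} {j} → glueAdj-symm G H v w {vertex i} {vertex j}
  ; irrefl = λ { {i} ≡.refl → glueAdj-irrefl G H v w (vertex i) }
  }
  where
  vertex : Fin (n + k) → Fin n ⊎ Fin (suc k)
  vertex i = Sum.map id (punchIn w) (splitAt n i)

------------------------------------------------------------------------
-- Scalars

-- The real numbers, characterised up to unique isomorphism as the complete
-- ordered field.  Decidability of the order reflects the classical reading.
record RealNumbers : Set₁ where
  field
    commutativeRing : CommutativeRing 0ℓ 0ℓ

  open CommutativeRing commutativeRing public renaming (_+_ to _+ʳ_)

  infix 4 _≤ʳ_ _<ʳ_

  field
    0≉1             : ¬ 0# ≈ 1#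
    inverse         : ∀ x → ¬ x ≈ 0# → ∃[ y ] x * y ≈ 1#
    _≤ʳ_            : Rel Carrier 0ℓ
    isDecTotalOrder : IsDecTotalOrder _≈_ _≤ʳ_
    +-monoˡ-≤       : ∀ z {x y} → x ≤ʳ y → (x +ʳ z) ≤ʳ (y +ʳ z)
    *-nonNegative   : ∀ {x y} → 0# ≤ʳ x → 0# ≤ʳ y → 0# ≤ʳ (x * y)

  UpperBound : Pred Carrier 0ℓ → Pred Carrier 0ℓ
  UpperBound P u = ∀ x → P x → x ≤ʳ u

  field
    supremum : (P : Pred Carrier 0ℓ) → (∃[ x ] P x) → (∃[ u ] UpperBound P u) →
               ∃[ s ] UpperBound P s × (∀ u → UpperBound P u → s ≤ʳ u)

  open IsDecTotalOrder isDecTotalOrder public using (_≟_; _≤?_)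

  _<ʳ_ : Rel Carrier 0ℓ
  x <ʳ y = x ≤ʳ y × ¬ x ≈ y

-- The interface shared by ℝ and ℂ; normSq is the squared modulus.
record Scalars (R : RealNumbers) : Set₁ where
  private
    module R = RealNumbers R
  field
    commutativeRing : CommutativeRing 0ℓ 0ℓ

  open CommutativeRing commutativeRing public

  field
    _≟_       : Decidable _≈_
    conj      : Carrier → Carrier
    conj-zero : ∀ {x} → x ≈ 0# → conj x ≈ 0#
    re        : Carrier → R.Carrier
    normSq    : Carrier → R.Carrier

module _ (R : RealNumbers) where
  open RealNumbers R

  realScalars : Scalars R
  realScalars = record
    { commutativeRing = commutativeRing
    ; _≟_             = _≟_
    ; conj            = λ x → x
    ; conj-zero       = λ p → p
    ; re              = λ x → x
    ; normSq          = λ x → x * x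
    }

  -- A pair (a , b) stands for a + b i.
  complexRing : CommutativeRing 0ℓ 0ℓ
  complexRing = record
    { Carrier = Carrier × Carrier
    ; _≈_     = _≈ᶜ_
    ; _+_     = _+ᶜ_
    ; _*_     = _*ᶜ_
    ; -_      = λ (a , b) → (- a , - b)
    ; 0#      = (0# , 0#)
    ; 1#      = (1# , 0#)
    ; isCommutativeRing = record
      { isRing = record
        { +-isAbelianGroup = AbelianGroup.isAbelianGroup A
        ; *-cong = λ (p , q) (r , s) →
            +-cong (*-cong p r) (-‿cong (*-cong q s)) ,
            +-cong (*-cong p s) (*-cong q r)
        ; *-assoc = λ (a , b) (c , d) (e , f) →
            (begin
              (a * c +ʳ - (b * d)) * e +ʳ - ((a * d +ʳ b * c) * f)
                ≈⟨ +-cong (*-congʳ (+-congˡ (neg _))) (neg _) ⟩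
              (a * c +ʳ - 1# * (b * d)) * e +ʳ - 1# * ((a * d +ʳ b * c) * f)
                ≈⟨ solve 7 (λ s a b c d e f →
                     (a :* c :+ s :* (b :* d)) :* e :+ s :* ((a :* d :+ b :* c) :* f) :=
                     a :* (c :* e :+ s :* (d :* f)) :+ s :* (b :* (c :* f :+ d :* e)))
                     refl (- 1#) a b c d e f ⟩
              a * (c * e +ʳ - 1# * (d * f)) +ʳ - 1# * (b * (c * f +ʳ d * e))
                ≈⟨ +-cong (*-congˡ (+-congˡ (neg _))) (neg _) ⟨
              a * (c * e +ʳ - (d * f)) +ʳ - (b * (c * f +ʳ d * e)) ∎) ,
            (begin
              (a * c +ʳ - (b * d)) * f +ʳ (a * d +ʳ b * c) * e
                ≈⟨ +-congʳ (*-congʳ (+-congˡ (neg _))) ⟩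
              (a * c +ʳ - 1# * (b * d)) * f +ʳ (a * d +ʳ b * c) * e
                ≈⟨ solve 7 (λ s a b c d e f →
                     (a :* c :+ s :* (b :* d)) :* f :+ (a :* d :+ b :* c) :* e :=
                     a :* (c :* f :+ d :* e) :+ b :* (c :* e :+ s :* (d :* f)))
                     refl (- 1#) a b c d e f ⟩
              a * (c * f +ʳ d * e) +ʳ b * (c * e +ʳ - 1# * (d * f))
                ≈⟨ +-congˡ (*-congˡ (+-congˡ (neg _))) ⟨
              a * (c * f +ʳ d * e) +ʳ b * (c * e +ʳ - (d * f)) ∎)
        ; *-identity = 1z , λ z → AbelianGroup.trans A (comm z _) (1z z)
        ; distrib = distˡ , λ x y z → AbelianGroup.trans A (comm (y +ᶜ z) x)
            (AbelianGroup.trans A (distˡ x y z)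
              (AbelianGroup.∙-cong A (comm x y) (comm x z)))
        }
      ; *-comm = comm
      }
    }
    where
    open SetoidReasoning setoid
    open RingProperties ring using (-0#≈0#; -1*x≈-x)
    open SemiringSolver commutativeSemiring using (solve; _:=_; _:+_; _:*_)

    A : AbelianGroup 0ℓ 0ℓ
    A = abelianGroup +-abelianGroup +-abelianGroup
    open AbelianGroup A using () renaming (_∙_ to _+ᶜ_; _≈_ to _≈ᶜ_)

    _*ᶜ_ : Op₂ (Carrier × Carrier)
    (a , b) *ᶜ (c , d) = (a * c +ʳ - (b * d) , a * d +ʳ b * c)

    neg : ∀ x → - x ≈ - 1# * x
    neg x = sym (-1*x≈-x x)

    comm : ∀ x y → (x *ᶜ y) ≈ᶜ (y *ᶜ x)
    comm (a , b) (c , d) =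
      +-cong (*-comm a c) (-‿cong (*-comm b d)) ,
      trans (+-comm (a * d) (b * c)) (+-cong (*-comm b c) (*-comm a d))

    1z : ∀ z → ((1# , 0#) *ᶜ z) ≈ᶜ z
    1z (a , b) =
      trans (+-cong (*-identityˡ a) (trans (-‿cong (zeroˡ b)) -0#≈0#)) (+-identityʳ a) ,
      trans (+-cong (*-identityˡ b) (zeroˡ a)) (+-identityʳ b)

    distˡ : ∀ x y z → (x *ᶜ (y +ᶜ z)) ≈ᶜ ((x *ᶜ y) +ᶜ (x *ᶜ z))
    distˡ (a , b) (c , d) (e , f) =
      (begin
        a * (c +ʳ e) +ʳ - (b * (d +ʳ f))
          ≈⟨ +-congˡ (neg _) ⟩
        a * (c +ʳ e) +ʳ - 1# * (b * (d +ʳ f))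
          ≈⟨ solve 7 (λ s a b c d e f →
               a :* (c :+ e) :+ s :* (b :* (d :+ f)) :=
               (a :* c :+ s :* (b :* d)) :+ (a :* e :+ s :* (b :* f)))
               refl (- 1#) a b c d e f ⟩
        (a * c +ʳ - 1# * (b * d)) +ʳ (a * e +ʳ - 1# * (b * f))
          ≈⟨ +-cong (+-congˡ (neg _)) (+-congˡ (neg _)) ⟨
        (a * c +ʳ - (b * d)) +ʳ (a * e +ʳ - (b * f)) ∎) ,
      solve 6 (λ a b c d e f →
        a :* (d :+ f) :+ b :* (c :+ e) :=
        (a :* d :+ b :* c) :+ (a :* f :+ b :* e))
        refl a b c d e f

  complexScalars : Scalars R
  complexScalars = record
    { commutativeRing = complexRing
    ; _≟_             = ×-decidable _≟_ _≟_
    ; conj            = λ (a , b) → (a , - b)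
    ; conj-zero       = λ (p , q) → p , trans (-‿cong q) -0#≈0#
    ; re              = proj₁
    ; normSq          = λ (a , b) → a * a +ʳ b * b
    }
    where open RingProperties ring using (-0#≈0#)

data ScalarKind : Set where
  real complex : ScalarKind

scalars : (R : RealNumbers) → ScalarKind → Scalars R
scalars R real    = realScalars R
scalars R complex = complexScalars R

------------------------------------------------------------------------
-- Inner product spaces and frames

-- Linear in the first argument, conjugate-linear in the second.
record InnerProductSpace {R : RealNumbers} (K : Scalars R) : Set₁ where
  private
    module R = RealNumbers R
    module K = Scalars K
  field
    vectorSpace : LeftModule K.ring 0ℓ 0ℓ

  open LeftModule vectorSpace public

  field
    ⟨_,_⟩     : Carrierᴹ → Carrierᴹ → K.Carrier
    ⟨⟩-cong   : ∀ {x x′ y y′} → x ≈ᴹ x′ → y ≈ᴹ y′ → ⟨ x , y ⟩ K.≈ ⟨ x′ , y′ ⟩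
    ⟨⟩-+ˡ     : ∀ x y z → ⟨ x +ᴹ y , z ⟩ K.≈ (⟨ x , z ⟩ K.+ ⟨ y , z ⟩)
    ⟨⟩-*ˡ     : ∀ a x y → ⟨ a *ₗ x , y ⟩ K.≈ (a K.* ⟨ x , y ⟩)
    ⟨⟩-conj   : ∀ x y → ⟨ y , x ⟩ K.≈ K.conj ⟨ x , y ⟩
    ⟨⟩-nonNeg : ∀ x → R.0# R.≤ʳ K.re ⟨ x , x ⟩
    ⟨⟩-def    : ∀ x → ⟨ x , x ⟩ K.≈ K.0# → x ≈ᴹ 0ᴹ

  ‖_‖² : Carrierᴹ → R.Carrier
  ‖ x ‖² = K.re ⟨ x , x ⟩

  combination : ∀ {k} → (Fin k → K.Carrier) → (Fin k → Carrierᴹ) → Carrierᴹ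
  combination c e = sum (λ i → c i *ₗ e i)
    where open RawMonoidSum +ᴹ-rawMonoid using (sum)

  record IsBasis {d} (e : Fin d → Carrierᴹ) : Set where
    field
      independent : ∀ c → combination c e ≈ᴹ 0ᴹ → ∀ i → c i K.≈ K.0#
      spanning    : ∀ x → ∃[ c ] combination c e ≈ᴹ x

  HasDimension : ℕ → Set
  HasDimension d = Σ[ e ∈ (Fin d → Carrierᴹ) ] IsBasis e

  IsFrame : ∀ {N} → (Fin N → Carrierᴹ) → Set
  IsFrame φ = ∃[ A ] ∃[ B ] R.0# R.<ʳ A × A R.≤ʳ B ×
    (∀ f → (A R.* ‖ f ‖²) R.≤ʳ sum (λ i → K.normSq ⟨ f , φ i ⟩) ×
           sum (λ i → K.normSq ⟨ f , φ i ⟩) R.≤ʳ (B R.* ‖ f ‖²))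
    where open RawMonoidSum R.+-rawMonoid using (sum)

  frameGraph : ∀ {N} → (Fin N → Carrierᴹ) → Graph N
  frameGraph φ = record
    { Adj    = λ i j → i ≢ j × ¬ ⟨ φ i , φ j ⟩ K.≈ K.0#
    ; adj?   = λ i j → ¬? (i Fin.≟ j) ×-dec ¬? (⟨ φ i , φ j ⟩ K.≟ K.0#)
    ; symm   = λ {i} {j} (i≢j , ≉0) → (λ j≡i → i≢j (≡.sym j≡i)) , λ ≈0 →
        ≉0 (K.trans (⟨⟩-conj (φ j) (φ i)) (K.conj-zero ≈0))
    ; irrefl = λ i≡j (i≢j , _) → i≢j i≡j
    }

IsFrameGraphIn : ∀ {R} {K : Scalars R} {n} → Graph n → InnerProductSpace K → Set
IsFrameGraphIn G V = ∃[ N ] Σ[ φ ∈ (Fin N → Carrierᴹ) ] IsFrame φ × frameGraph φ ≅ G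
  where open InnerProductSpace V

IsFrameGraphInDim : ∀ {R} → Scalars R → ℕ → ∀ {n} → Graph n → Set₁
IsFrameGraphInDim K d G =
  Σ[ V ∈ InnerProductSpace K ] InnerProductSpace.HasDimension V d × IsFrameGraphIn G V

IsJustFrameGraph : RealNumbers → ∀ {n} → Graph n → ℕ → ℕ → Set₁
IsJustFrameGraph R G a b = ∀ 𝔽 d → 1 ≤ d →
  IsFrameGraphInDim (scalars R 𝔽) d G ⇔ (a ≤ d × d ≤ b)

{-# OPTIONS --safe #-}
module Submission where

open import Defs
open import Algebra.Bundles using (CommutativeRing; RawRing)
import Algebra.Construct.Pointwise as Pointwise
import Algebra.Properties.Ring as RingProperties
import Algebra.Properties.Semiring.Mult.TCOptimised as Multiples
import Algebra.Properties.Semiring.Sum as SemiringSum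
import Algebra.Solver.Ring as RingSolver
open import Algebra.Solver.Ring.AlmostCommutativeRing
  using (fromCommutativeRing; _-Raw-AlmostCommutative⟶_)
import Algebra.Solver.Ring.NaturalCoefficients.Default as SemiringSolver
open import Data.Fin.Base
  using (Fin; zero; suc; punchIn; _↑ˡ_; _↑ʳ_; toℕ; combine; splitAt; punchOut; remQuot)
import Data.Fin.Properties as Fin
open import Data.Maybe.Base using (Maybe; just; nothing)
import Data.Nat.Base as ℕ
open import Data.Nat.Base using (ℕ; zero; suc; _≤_; _<_; z≤n; s≤s; _^_)
import Data.Nat.Properties as ℕ
open import Data.Product.Base using (_×_; _,_; proj₁; proj₂; ∃-syntax; Σ-syntax)
import Data.Sum.Base as Sum
open import Data.Sum.Base using (_⊎_; inj₁; inj₂)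
open import Data.Sum.Properties using (inj₁-injective; inj₂-injective)
open import Data.Unit.Base using (tt)
open import Data.Vec.Functional using (_∷_; _++_)
open import Data.Vec.Functional.Properties using (lookup-++ˡ; lookup-++ʳ)
open import Function.Base using (_∘_; case_of_; id)
open import Function.Bundles
  using (_⇔_; mk⇔; module Equivalence; module Injection; module Inverse)
open import Function.Construct.Identity using (↔-id)
open import Function.Definitions using (Injective)
open import Function.Properties.Inverse using (↔⇒↣)
open import Level using (0ℓ)
open import Relation.Binary.Construct.Closure.ReflexiveTransitive using (Star; ε; _◅_)
import Relation.Binary.PropositionalEquality as ≡
open import Relation.Binary.PropositionalEquality using (_≡_; _≢_)
import Relation.Binary.Reasoning.Setoid as SetoidReasoning
open import Relation.Binary.Structures using (IsDecTotalOrder)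
open import Relation.Nullary using (yes; no; ¬_; Dec; ¬?; contradiction)
open import Relation.Nullary.Decidable using (decidable-stable)

-- Forget that a frame has to span: call vectors of 𝔽ᵈ whose non-orthogonal pairs are the
-- edges of a graph a representation of it.  A representation in dimension d of a graph
-- with at least d vertices can be made spanning: if u is orthogonal to all the vectors,
-- adding u to one of them that is redundant for the span changes none of the other inner
-- products and enlarges the span.  So the graph is a frame graph in dimension d if and only
-- if d is at most its order and it has a representation in dimension d, a condition which
-- is inherited by larger d and by induced subgraphs.
--
-- For the join it remains to represent G ∨ H in dimension n′.  Represent G and H there,
-- and apply to the vectors of H the reflection in a hyperplane z⊥.  The inner products
-- with the vectors of G are nonzero quadratics in z, so some z keeps all of them nonzero.
--
-- For G.H, an orthogonal sum of representations gives the dimension n′ + m′.  Conversely, in a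
-- representation of G.H the vectors of G - v and of H - w span orthogonal subspaces, and
-- projecting the common vector to each of them represents G and H separately.

-- An abstract space is moved to coordinates by an orthonormal basis, and normalising a vector takes
-- a square root; this is where completeness of the reals enters. A reflection is used for the join
-- because its inner products are polynomial in `z`, so that genericity becomes a count of roots. A
-- single pair of nonzero vectors always has a good direction. If `x` is good for some pairs and `y`
-- for one more, then on the line `x + t y` each of these pairs excludes at most two values of `t`,
-- so natural numbers already supply a good one. The vectors are nonzero because a connected graph
-- with more than one vertex has no isolated vertex. The hypothesis on `G` does not assert `n′ ≤ n`.
-- This follows from the fact that every graph of order `n` has a representation in dimension `n`,
-- and it makes dimension `n′` itself available.

-- The ring solver with integer coefficients; a pair (a , b) with one of a and b
-- zero stands for a - b, so that equal integers have the same normal form.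
module IntegerSolver (A : CommutativeRing 0ℓ 0ℓ) where
  open CommutativeRing A
  open RingProperties ring using (-1*x≈-x; -‿involutive)
  open Multiples semiring using (×-homo-+; ×1-homo-*) renaming (_×_ to _⋆_)
  open SetoidReasoning setoid
  private
    module S = SemiringSolver commutativeSemiring

    difference : ℕ → ℕ → ℕ × ℕ
    difference a       zero    = a , 0
    difference zero    (suc b) = 0 , suc b
    difference (suc a) (suc b) = difference a b

    value : ℕ × ℕ → Carrier
    value (a , zero)  = a ⋆ 1#
    value (a , suc b) = a ⋆ 1# + - (suc b ⋆ 1#)

    -- This uniform shape treats `- 1#` as an opaque scalar, so that the semiring solver can handle
    -- signs; the facts peculiar to `- 1#` are applied by hand.
    value-pair : ∀ a b → value (a , b) ≈ a ⋆ 1# + - 1# * (b ⋆ 1#)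
    value-pair a zero    = sym (trans (+-congˡ (zeroʳ _)) (+-identityʳ _))
    value-pair a (suc b) = +-congˡ (sym (-1*x≈-x _))

    value-difference : ∀ a b → value (difference a b) ≈ a ⋆ 1# + - 1# * (b ⋆ 1#)
    value-difference a       zero    = value-pair a 0
    value-difference zero    (suc b) = value-pair 0 (suc b)
    value-difference (suc a) (suc b) = begin
      value (difference a b)                     ≈⟨ value-difference a b ⟩
      a ⋆ 1# + - 1# * (b ⋆ 1#)                   ≈⟨ +-identityˡ _ ⟨
      0# + (a ⋆ 1# + - 1# * (b ⋆ 1#))            ≈⟨ +-congʳ (trans (+-congˡ (-1*x≈-x _)) (-‿inverseʳ 1#)) ⟨
      (1# + - 1# * 1#) + (a ⋆ 1# + - 1# * (b ⋆ 1#))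
        ≈⟨ S.solve 4 (λ o s x y → (o S.:+ s S.:* o) S.:+ (x S.:+ s S.:* y) S.:=
                                  (o S.:+ x) S.:+ s S.:* (o S.:+ y)) refl 1# (- 1#) _ _ ⟩
      (1# + a ⋆ 1#) + - 1# * (1# + b ⋆ 1#)       ≈⟨ +-cong (×-homo-+ 1# 1 a) (*-congˡ (×-homo-+ 1# 1 b)) ⟨
      suc a ⋆ 1# + - 1# * (suc b ⋆ 1#)           ∎

    integers : RawRing 0ℓ 0ℓ
    integers = record
      { Carrier = ℕ × ℕ
      ; _≈_     = _≡_
      ; _+_     = λ (a , b) (c , d) → difference (a ℕ.+ c) (b ℕ.+ d)
      ; _*_     = λ (a , b) (c , d) → difference (a ℕ.* c ℕ.+ b ℕ.* d) (a ℕ.* d ℕ.+ b ℕ.* c)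
      ; -_      = λ (a , b) → difference b a
      ; 0#      = 0 , 0
      ; 1#      = 1 , 0
      }

    -1*-1≈1 : - 1# * - 1# ≈ 1#
    -1*-1≈1 = trans (-1*x≈-x (- 1#)) (-‿involutive 1#)

    +-homo : ∀ x y → value (RawRing._+_ integers x y) ≈ value x + value y
    +-homo (a , b) (c , d) = begin
      value (difference (a ℕ.+ c) (b ℕ.+ d)) ≈⟨ value-difference (a ℕ.+ c) (b ℕ.+ d) ⟩
      (a ℕ.+ c) ⋆ 1# + - 1# * ((b ℕ.+ d) ⋆ 1#)
        ≈⟨ +-cong (×-homo-+ 1# a c) (*-congˡ (×-homo-+ 1# b d)) ⟩
      (a ⋆ 1# + c ⋆ 1#) + - 1# * (b ⋆ 1# + d ⋆ 1#)
        ≈⟨ S.solve 5 (λ s a b c d → (a S.:+ c) S.:+ s S.:* (b S.:+ d) S.:=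
                        (a S.:+ s S.:* b) S.:+ (c S.:+ s S.:* d)) refl (- 1#) _ _ _ _ ⟩
      (a ⋆ 1# + - 1# * (b ⋆ 1#)) + (c ⋆ 1# + - 1# * (d ⋆ 1#))
        ≈⟨ +-cong (value-pair a b) (value-pair c d) ⟨
      value (a , b) + value (c , d) ∎

    *-homo : ∀ x y → value (RawRing._*_ integers x y) ≈ value x * value y
    *-homo (a , b) (c , d) = begin
      value (difference (a ℕ.* c ℕ.+ b ℕ.* d) (a ℕ.* d ℕ.+ b ℕ.* c))
        ≈⟨ value-difference (a ℕ.* c ℕ.+ b ℕ.* d) (a ℕ.* d ℕ.+ b ℕ.* c) ⟩
      (a ℕ.* c ℕ.+ b ℕ.* d) ⋆ 1# + - 1# * ((a ℕ.* d ℕ.+ b ℕ.* c) ⋆ 1#)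
        ≈⟨ +-cong (split a c b d) (*-congˡ (split a d b c)) ⟩
      (a ⋆ 1# * c ⋆ 1# + b ⋆ 1# * d ⋆ 1#) + - 1# * (a ⋆ 1# * d ⋆ 1# + b ⋆ 1# * c ⋆ 1#)
        ≈⟨ +-congʳ (+-congˡ (trans (*-congʳ -1*-1≈1) (*-identityˡ _))) ⟨
      (a ⋆ 1# * c ⋆ 1# + - 1# * - 1# * (b ⋆ 1# * d ⋆ 1#)) + - 1# * (a ⋆ 1# * d ⋆ 1# + b ⋆ 1# * c ⋆ 1#)
        ≈⟨ S.solve 5 (λ s a b c d →
             (a S.:* c S.:+ s S.:* s S.:* (b S.:* d)) S.:+ s S.:* (a S.:* d S.:+ b S.:* c) S.:=
             (a S.:+ s S.:* b) S.:* (c S.:+ s S.:* d)) refl (- 1#) _ _ _ _ ⟩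
      (a ⋆ 1# + - 1# * (b ⋆ 1#)) * (c ⋆ 1# + - 1# * (d ⋆ 1#))
        ≈⟨ *-cong (value-pair a b) (value-pair c d) ⟨
      value (a , b) * value (c , d) ∎
      where
      split : ∀ a c b d → (a ℕ.* c ℕ.+ b ℕ.* d) ⋆ 1# ≈ a ⋆ 1# * c ⋆ 1# + b ⋆ 1# * d ⋆ 1#
      split a c b d = trans (×-homo-+ 1# (a ℕ.* c) (b ℕ.* d)) (+-cong (×1-homo-* a c) (×1-homo-* b d))

    -‿homo : ∀ x → value (RawRing.-_ integers x) ≈ - value x
    -‿homo (a , b) = begin
      value (difference b a)           ≈⟨ value-difference b a ⟩
      b ⋆ 1# + - 1# * (a ⋆ 1#)          ≈⟨ +-congʳ (trans (*-congʳ -1*-1≈1) (*-identityˡ _)) ⟨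
      - 1# * - 1# * (b ⋆ 1#) + - 1# * (a ⋆ 1#)
        ≈⟨ S.solve 3 (λ s a b → s S.:* s S.:* b S.:+ s S.:* a S.:= s S.:* (a S.:+ s S.:* b))
             refl (- 1#) _ _ ⟩
      - 1# * (a ⋆ 1# + - 1# * (b ⋆ 1#)) ≈⟨ -1*x≈-x _ ⟩
      - (a ⋆ 1# + - 1# * (b ⋆ 1#))      ≈⟨ -‿cong (value-pair a b) ⟨
      - value (a , b)                  ∎

    morphism : integers -Raw-AlmostCommutative⟶ fromCommutativeRing A
    morphism = record
      { ⟦_⟧ = value ; +-homo = +-homo ; *-homo = *-homo ; -‿homo = -‿homo
      ; 0-homo = refl ; 1-homo = refl }

    value≟ : ∀ x y → Maybe (value x ≈ value y)
    value≟ (a , b) (c , d) with a ℕ.≟ c | b ℕ.≟ d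
    ... | yes ≡.refl | yes ≡.refl = just refl
    ... | _          | _          = nothing

  open RingSolver integers (fromCommutativeRing A) morphism value≟ public
    using (solve; _:=_; _:+_; _:*_; :-_; _:-_; con)

HasInverses : CommutativeRing 0ℓ 0ℓ → Set
HasInverses A = ∀ x → ¬ x ≈ 0# → ∃[ y ] x * y ≈ 1#
  where open CommutativeRing A

module Field (A : CommutativeRing 0ℓ 0ℓ) (inverse : HasInverses A) where
  open CommutativeRing A
  open IntegerSolver A

  x+[y-x]≈y : ∀ x y → x + (y - x) ≈ y
  x+[y-x]≈y = solve 2 (λ x y → x :+ (y :- x) := y) refl

  y-x≈0⇒x≈y : ∀ {x y} → y - x ≈ 0# → x ≈ y
  y-x≈0⇒x≈y {x} {y} e = trans (sym (+-identityʳ x)) (trans (+-congˡ (sym e)) (x+[y-x]≈y x y))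

  x*y≈0⇒y≈0 : ∀ {x y} → ¬ x ≈ 0# → x * y ≈ 0# → y ≈ 0#
  x*y≈0⇒y≈0 {x} {y} x≉0 xy≈0 with inverse x x≉0
  ... | z , xz≈1 =
    trans (sym (*-identityˡ y)) (trans (*-congʳ (sym xz≈1))
      (trans (solve 3 (λ x y z → x :* z :* y := z :* (x :* y)) refl x y z)
        (trans (*-congˡ xy≈0) (zeroʳ z))))

  ≉0-* : ∀ {x y} → ¬ x ≈ 0# → ¬ y ≈ 0# → ¬ x * y ≈ 0#
  ≉0-* x≉0 y≉0 xy≈0 = y≉0 (x*y≈0⇒y≈0 x≉0 xy≈0)

-- Square roots in ordered fields

module OrderedField (R : RealNumbers) where
  open RealNumbers R
  open Field commutativeRing inverse
  open IntegerSolver commutativeRing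
  module ≤ = IsDecTotalOrder isDecTotalOrder

  0≤-resp : ∀ {x y} → x ≈ y → 0# ≤ʳ x → 0# ≤ʳ y
  0≤-resp = ≤.≤-respʳ-≈

  +-mono-≤ : ∀ {w x y z} → w ≤ʳ x → y ≤ʳ z → (w +ʳ y) ≤ʳ (x +ʳ z)
  +-mono-≤ {w} {x} {y} {z} w≤x y≤z = ≤.trans (+-monoˡ-≤ y w≤x)
    (≤.≤-respˡ-≈ (+-comm y x) (≤.≤-respʳ-≈ (+-comm z x) (+-monoˡ-≤ x y≤z)))

  +-nonNegative : ∀ {x y} → 0# ≤ʳ x → 0# ≤ʳ y → 0# ≤ʳ (x +ʳ y)
  +-nonNegative p q = ≤.≤-respˡ-≈ (+-identityˡ 0#) (+-mono-≤ p q)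

  x≤y⇒0≤y-x : ∀ {x y} → x ≤ʳ y → 0# ≤ʳ (y - x)
  x≤y⇒0≤y-x {x} p = ≤.≤-respˡ-≈ (-‿inverseʳ x) (+-monoˡ-≤ (- x) p)

  0≤y-x⇒x≤y : ∀ {x y} → 0# ≤ʳ (y - x) → x ≤ʳ y
  0≤y-x⇒x≤y {x} {y} p = ≤.≤-respˡ-≈ (+-identityˡ x) (≤.≤-respʳ-≈
    (solve 2 (λ x y → (y :- x) :+ x := y) refl x y) (+-monoˡ-≤ x p))

  x≤0⇒0≤-x : ∀ {x} → x ≤ʳ 0# → 0# ≤ʳ - x
  x≤0⇒0≤-x p = 0≤-resp (+-identityˡ _) (x≤y⇒0≤y-x p)

  x≤x+y : ∀ {x y} → 0# ≤ʳ y → x ≤ʳ (x +ʳ y)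
  x≤x+y {x} {y} p = 0≤y-x⇒x≤y (0≤-resp (solve 2 (λ x y → y := x :+ y :- x) refl x y) p)

  *-monoʳ-≤ : ∀ {x y z} → 0# ≤ʳ z → x ≤ʳ y → (z * x) ≤ʳ (z * y)
  *-monoʳ-≤ {x} {y} {z} 0≤z x≤y = 0≤y-x⇒x≤y (0≤-resp
    (solve 3 (λ x y z → z :* (y :- x) := z :* y :- z :* x) refl x y z)
    (*-nonNegative 0≤z (x≤y⇒0≤y-x x≤y)))

  square-nonNegative : ∀ x → 0# ≤ʳ (x * x)
  square-nonNegative x with ≤.total 0# x
  ... | inj₁ p = *-nonNegative p p
  ... | inj₂ p = 0≤-resp (solve 1 (λ x → :- x :* :- x := x :* x) refl x)
                         (*-nonNegative (x≤0⇒0≤-x p) (x≤0⇒0≤-x p))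

  0≤1 : 0# ≤ʳ 1#
  0≤1 = 0≤-resp (*-identityˡ 1#) (square-nonNegative 1#)

  -- Here `y` equals `x * (y * y)`, a product of nonnegative factors.
  inverse-nonNegative : ∀ {x y} → x * y ≈ 1# → 0# ≤ʳ x → 0# ≤ʳ y
  inverse-nonNegative {x} {y} xy≈1 0≤x = 0≤-resp
    (trans (sym (*-assoc x y y)) (trans (*-congʳ xy≈1) (*-identityˡ y)))
    (*-nonNegative 0≤x (square-nonNegative y))

  x+y≈0⇒x≈0 : ∀ {x y} → 0# ≤ʳ x → 0# ≤ʳ y → x +ʳ y ≈ 0# → x ≈ 0#
  x+y≈0⇒x≈0 0≤x 0≤y e = ≤.antisym (≤.≤-respʳ-≈ e (x≤x+y 0≤y)) 0≤x

  x*x≈0⇒x≈0 : ∀ {x} → x * x ≈ 0# → x ≈ 0#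
  x*x≈0⇒x≈0 {x} e with x ≟ 0#
  ... | yes x≈0 = x≈0
  ... | no  x≉0 = x*y≈0⇒y≈0 x≉0 e

  1+x≉0 : ∀ {x} → 0# ≤ʳ x → ¬ 1# +ʳ x ≈ 0#
  1+x≉0 0≤x e = 0≉1 (sym (x+y≈0⇒x≈0 0≤1 0≤x e))

  -- If `y ≤ x`, then `x² - y² = (x - y)² + 2 y (x - y)` with both summands nonnegative, so
  -- `x² ≤ y²` forces `(x - y)² = 0`.
  square-cancel-≤ : ∀ {x y} → 0# ≤ʳ y → (x * x) ≤ʳ (y * y) → x ≤ʳ y
  square-cancel-≤ {x} {y} 0≤y xx≤yy with ≤.total x y
  ... | inj₁ x≤y = x≤y
  ... | inj₂ y≤x = ≤.reflexive (sym (y-x≈0⇒x≈y (x*x≈0⇒x≈0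
      (x+y≈0⇒x≈0 (square-nonNegative (x - y)) 0≤2y[x-y] (≤.antisym difference≤0
        (+-nonNegative (square-nonNegative (x - y)) 0≤2y[x-y]))))))
    where
    0≤2y[x-y] : 0# ≤ʳ ((y +ʳ y) * (x - y))
    0≤2y[x-y] = *-nonNegative (+-nonNegative 0≤y 0≤y) (x≤y⇒0≤y-x y≤x)

    difference≤0 : ((x - y) * (x - y) +ʳ (y +ʳ y) * (x - y)) ≤ʳ 0#
    difference≤0 = 0≤y-x⇒x≤y (0≤-resp
      (solve 2 (λ x y → y :* y :- x :* x :=
        con (0 , 0) :- ((x :- y) :* (x :- y) :+ (y :+ y) :* (x :- y))) refl x y)
      (x≤y⇒0≤y-x xx≤yy))

  x+y≤x⇒y≈0 : ∀ {x y} → 0# ≤ʳ y → (x +ʳ y) ≤ʳ x → y ≈ 0#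
  x+y≤x⇒y≈0 {x} {y} 0≤y p = ≤.antisym (0≤y-x⇒x≤y (0≤-resp
     (solve 2 (λ x y → x :- (x :+ y) := con (0 , 0) :- y) refl x y) (x≤y⇒0≤y-x p))) 0≤y

  -- With D E = 1, D = 1 + 2 s + δ and D = 2 s respectively, the second factor of
  -- the last summand vanishes: these are the Newton-like steps towards √a.
  increment-square : ∀ s δ E → (s * s +ʳ δ) - (s +ʳ δ * E) * (s +ʳ δ * E) ≈
    δ * E * ((1# +ʳ (s +ʳ s)) * E +ʳ δ) +ʳ (δ +ʳ δ * E) * (1# - (1# +ʳ (s +ʳ s +ʳ δ)) * E)
  increment-square = solve 3 (λ s δ E →
    (s :* s :+ δ) :- (s :+ δ :* E) :* (s :+ δ :* E) :=
    δ :* E :* ((con (1 , 0) :+ (s :+ s)) :* E :+ δ) :+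
    (δ :+ δ :* E) :* (con (1 , 0) :- (con (1 , 0) :+ (s :+ s :+ δ)) :* E)) refl

  decrement-square : ∀ s δ E → (s - δ * E) * (s - δ * E) - (s * s - δ) ≈
    δ * E * (δ * E) +ʳ δ * (1# - (s +ʳ s) * E)
  decrement-square = solve 3 (λ s δ E →
    (s :- δ :* E) :* (s :- δ :* E) :- (s :* s :- δ) :=
    δ :* E :* (δ :* E) :+ δ :* (con (1 , 0) :- (s :+ s) :* E)) refl

  decrement : ∀ s δ E → s - δ * E ≈ E * (s * s +ʳ (s * s - δ)) +ʳ s * (1# - (s +ʳ s) * E)
  decrement = solve 3 (λ s δ E → s :- δ :* E :=
    E :* (s :* s :+ (s :* s :- δ)) :+ s :* (con (1 , 0) :- (s :+ s) :* E)) refl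

  +-vanishing : ∀ {x y z} → z ≈ 1# → x +ʳ y * (1# - z) ≈ x
  +-vanishing {x} {y} z≈1 =
    trans (+-congˡ (trans (*-congˡ (trans (+-congˡ (-‿cong z≈1)) (-‿inverseʳ 1#))) (zeroʳ y)))
          (+-identityʳ x)

  x*E≈0⇒x≈0 : ∀ {x D E} → D * E ≈ 1# → x * E ≈ 0# → x ≈ 0#
  x*E≈0⇒x≈0 {x} {D} {E} DE≈1 xE≈0 = x*y≈0⇒y≈0
    (λ E≈0 → 0≉1 (trans (sym (zeroʳ D)) (trans (*-congˡ (sym E≈0)) DE≈1)))
    (trans (*-comm E x) xE≈0)

  -- With `E = 1 / (1 + 2 s + δ)` the square of `s + δ E` does not exceed `s² + δ`, so the bound `s`
  -- forces `δ E ≤ 0`. The summand 1 keeps the denominator invertible when `s` and `δ` vanish.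
  no-increment : ∀ {s δ} → 0# ≤ʳ s → 0# ≤ʳ δ →
                 (∀ x → (x * x) ≤ʳ (s * s +ʳ δ) → x ≤ʳ s) → δ ≈ 0#
  no-increment {s} {δ} 0≤s 0≤δ upper = go (inverse (1# +ʳ (s +ʳ s +ʳ δ)) (1+x≉0 0≤2s+δ))
    where
    0≤2s+δ : 0# ≤ʳ (s +ʳ s +ʳ δ)
    0≤2s+δ = +-nonNegative (+-nonNegative 0≤s 0≤s) 0≤δ

    go : ∃[ E ] (1# +ʳ (s +ʳ s +ʳ δ)) * E ≈ 1# → δ ≈ 0#
    go (E , DE≈1) = x*E≈0⇒x≈0 DE≈1 (x+y≤x⇒y≈0 (*-nonNegative 0≤δ 0≤E)
      (upper (s +ʳ δ * E) (0≤y-x⇒x≤y (0≤-resp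
        (sym (trans (increment-square s δ E) (+-vanishing DE≈1)))
        (*-nonNegative (*-nonNegative 0≤δ 0≤E) (+-nonNegative
          (*-nonNegative (+-nonNegative 0≤1 (+-nonNegative 0≤s 0≤s)) 0≤E) 0≤δ))))))
      where
      0≤E : 0# ≤ʳ E
      0≤E = inverse-nonNegative DE≈1 (+-nonNegative 0≤1 0≤2s+δ)

  -- With `E = 1 / (2 s)`, `s - δ E` is the Newton step from `s` towards the root of `s² - δ`. It
  -- stays nonnegative and its square is at least `s² - δ`, so minimality of `s` forces `δ E ≤ 0`.
  no-decrement : ∀ {s δ} → 0# ≤ʳ s → 0# ≤ʳ δ → ¬ s ≈ 0# → 0# ≤ʳ (s * s - δ) →
                 (∀ u → 0# ≤ʳ u → (s * s - δ) ≤ʳ (u * u) → s ≤ʳ u) → δ ≈ 0#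
  no-decrement {s} {δ} 0≤s 0≤δ s≉0 0≤ss-δ least =
    go (inverse (s +ʳ s) (λ e → s≉0 (x+y≈0⇒x≈0 0≤s 0≤s e)))
    where
    go : ∃[ E ] (s +ʳ s) * E ≈ 1# → δ ≈ 0#
    go (E , DE≈1) = x*E≈0⇒x≈0 DE≈1 (x+y≤x⇒y≈0 0≤ε
      (≤.≤-respʳ-≈ (solve 2 (λ s e → s :- e :+ e := s) refl s (δ * E)) (+-monoˡ-≤ (δ * E)
        (least (s - δ * E)
          (0≤-resp (sym (trans (decrement s δ E) (+-vanishing DE≈1)))
            (*-nonNegative 0≤E (+-nonNegative (square-nonNegative s) 0≤ss-δ)))
          (0≤y-x⇒x≤y (0≤-resp (sym (trans (decrement-square s δ E) (+-vanishing DE≈1)))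
            (square-nonNegative (δ * E))))))))
      where
      0≤E : 0# ≤ʳ E
      0≤E = inverse-nonNegative DE≈1 (+-nonNegative 0≤s 0≤s)
      0≤ε : 0# ≤ʳ (δ * E)
      0≤ε = *-nonNegative 0≤δ 0≤E

  x-[x-y]≈y : ∀ x y → x - (x - y) ≈ y
  x-[x-y]≈y = solve 2 (λ x y → x :- (x :- y) := y) refl

  square-root : ∀ a → 0# ≤ʳ a → ∃[ s ] s * s ≈ a
  square-root a 0≤a = go (supremum (λ x → (x * x) ≤ʳ a)
    (0# , ≤.≤-respˡ-≈ (sym (zeroˡ 0#)) 0≤a)
    -- `1 + a` bounds the set because `(1 + a)² - a = 1 + a + a²` is nonnegative.
    (1# +ʳ a , λ x xx≤a → square-cancel-≤ (+-nonNegative 0≤1 0≤a) (≤.trans xx≤a (0≤y-x⇒x≤y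
      (0≤-resp (solve 1 (λ a → con (1 , 0) :+ (a :+ a :* a) :=
                               (con (1 , 0) :+ a) :* (con (1 , 0) :+ a) :- a) refl a)
        (+-nonNegative 0≤1 (+-nonNegative 0≤a (*-nonNegative 0≤a 0≤a))))))))
    where
    go : ∃[ s ] UpperBound (λ x → (x * x) ≤ʳ a) s ×
         (∀ u → UpperBound (λ x → (x * x) ≤ʳ a) u → s ≤ʳ u) → ∃[ s ] s * s ≈ a
    go (s , upper , least) = s , compare (≤.total a (s * s))
      where
      0≤s : 0# ≤ʳ s
      0≤s = upper 0# (≤.≤-respˡ-≈ (sym (zeroˡ 0#)) 0≤a)

      compare : a ≤ʳ (s * s) ⊎ (s * s) ≤ʳ a → s * s ≈ a
      compare (inj₂ ss≤a) = y-x≈0⇒x≈y (no-increment 0≤s (x≤y⇒0≤y-x ss≤a)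
        (λ x p → upper x (≤.≤-respʳ-≈ (x+[y-x]≈y (s * s) a) p)))
      compare (inj₁ a≤ss) with s ≟ 0#
      -- The Newton step divides by `2 s`; for `s = 0` the bound `a ≤ s²` already gives `a = 0`.
      ... | yes s≈0 = ≤.antisym (≤.≤-respˡ-≈ (sym (trans (*-congʳ s≈0) (zeroˡ s))) 0≤a) a≤ss
      ... | no  s≉0 = sym (y-x≈0⇒x≈y (no-decrement 0≤s (x≤y⇒0≤y-x a≤ss) s≉0
        (0≤-resp (sym (x-[x-y]≈y (s * s) a)) 0≤a)
        (λ u 0≤u p → least u (λ x xx≤a → square-cancel-≤ 0≤u
          (≤.trans xx≤a (≤.≤-respˡ-≈ (x-[x-y]≈y (s * s) a) p))))))

  -- Turns an estimate of the norm by the frame sum into a lower frame bound `A = 1 / (1 + C)`,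
  -- where the 1 makes `A` exist and be positive even for `C = 0`.
  invert-bound : ∀ {C A s x} → (1# +ʳ C) * A ≈ 1# → 0# ≤ʳ A → 0# ≤ʳ s →
                 x ≤ʳ (C * s) → (A * x) ≤ʳ s
  invert-bound {C} {A} {s} {x} DA≈1 0≤A 0≤s x≤Cs = 0≤y-x⇒x≤y (0≤-resp
    (sym (trans (solve 4 (λ C A s x → s :- A :* x :=
             A :* (C :* s :- x) :+ A :* s :+ s :* (con (1 , 0) :- (con (1 , 0) :+ C) :* A))
             refl C A s x) (+-vanishing DA≈1)))
    (+-nonNegative (*-nonNegative 0≤A (x≤y⇒0≤y-x x≤Cs)) (*-nonNegative 0≤A 0≤s)))

  -- Replacing `B` by `A + B` secures the inequality between the two bounds that `IsFrame` demands.
  weaken-bound : ∀ {A B s x} → 0# ≤ʳ A → 0# ≤ʳ x → s ≤ʳ (B * x) → s ≤ʳ ((A +ʳ B) * x)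
  weaken-bound {A} {B} {s} {x} 0≤A 0≤x s≤Bx = ≤.trans s≤Bx (0≤y-x⇒x≤y (0≤-resp
    (solve 3 (λ A B x → A :* x := (A :+ B) :* x :- B :* x) refl A B x) (*-nonNegative 0≤A 0≤x)))

-- Real and complex scalars

-- What the argument uses of ℝ and ℂ, so that it runs once for both. `absolute-root` is the form of
-- the square root that normalises vectors. `normSq-+`, with its factor 2, gives frame bounds
-- without the Cauchy-Schwarz inequality.
record IsStarField {R : RealNumbers} (K : Scalars R) : Set where
  private
    module R = RealNumbers R
  open Scalars K
  field
    0≉1             : ¬ 0# ≈ 1#
    inverse         : ∀ x → ¬ x ≈ 0# → ∃[ y ] x * y ≈ 1#
    conj-cong       : ∀ {x y} → x ≈ y → conj x ≈ conj y
    conj-+          : ∀ x y → conj (x + y) ≈ conj x + conj y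
    conj-*          : ∀ x y → conj (x * y) ≈ conj x * conj y
    conj-involutive : ∀ x → conj (conj x) ≈ x
    re-cong         : ∀ {x y} → x ≈ y → re x R.≈ re y
    re-+            : ∀ x y → re (x + y) R.≈ (re x R.+ʳ re y)
    re-x*conjx      : ∀ x → re (x * conj x) R.≈ normSq x
    normSq-*        : ∀ x y → normSq (x * y) R.≈ (normSq x R.* normSq y)
    normSq-+        : ∀ x y → normSq (x + y) R.≤ʳ
                              ((normSq x R.+ʳ normSq y) R.+ʳ (normSq x R.+ʳ normSq y))
    normSq-nonNeg   : ∀ x → R.0# R.≤ʳ normSq x
    normSq-def      : ∀ {x} → normSq x R.≈ R.0# → x ≈ 0#
    absolute-root   : ∀ x → conj x ≈ x → R.0# R.≤ʳ re x → ∃[ s ] s * conj s ≈ x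

module _ (R : RealNumbers) where
  open RealNumbers R
  open OrderedField R
  open IntegerSolver commutativeRing
  open RingProperties ring using (-‿involutive; -‿+-comm)

  square-+ : ∀ x y → ((x +ʳ y) * (x +ʳ y)) ≤ʳ ((x * x +ʳ y * y) +ʳ (x * x +ʳ y * y))
  square-+ x y = 0≤y-x⇒x≤y (0≤-resp
    (solve 2 (λ x y → (x :- y) :* (x :- y) :=
      ((x :* x :+ y :* y) :+ (x :* x :+ y :* y)) :- (x :+ y) :* (x :+ y)) refl x y)
    (square-nonNegative (x - y)))

  real-isStarField : IsStarField (realScalars R)
  real-isStarField = record
    { 0≉1             = 0≉1
    ; inverse         = inverse
    ; conj-cong       = λ p → p
    ; conj-+          = λ _ _ → refl
    ; conj-*          = λ _ _ → refl
    ; conj-involutive = λ _ → refl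
    ; re-cong         = λ p → p
    ; re-+            = λ _ _ → refl
    ; re-x*conjx      = λ _ → refl
    ; normSq-*        = solve 2 (λ x y → (x :* y) :* (x :* y) := (x :* x) :* (y :* y)) refl
    ; normSq-+        = square-+
    ; normSq-nonNeg   = square-nonNegative
    ; normSq-def      = x*x≈0⇒x≈0
    ; absolute-root   = λ x _ → square-root x
    }

  x*x+y*y≈0⇒x≈0 : ∀ {x y} → x * x +ʳ y * y ≈ 0# → x ≈ 0#
  x*x+y*y≈0⇒x≈0 {x} {y} e = x*x≈0⇒x≈0 (x+y≈0⇒x≈0 (square-nonNegative x) (square-nonNegative y) e)

  -x≈x⇒x≈0 : ∀ {x} → - x ≈ x → x ≈ 0#
  -x≈x⇒x≈0 {x} e = x*x+y*y≈0⇒x≈0 {x} {x} (trans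
    (solve 1 (λ x → x :* x :+ x :* x := x :* (x :- :- x)) refl x)
    (trans (*-congˡ (trans (+-congˡ (-‿cong e)) (-‿inverseʳ x))) (zeroʳ x)))

  complex-isStarField : IsStarField (complexScalars R)
  complex-isStarField = record
    { 0≉1             = λ (0≈1 , _) → 0≉1 0≈1
    ; inverse         = complex-inverse
    ; conj-cong       = λ (p , q) → p , -‿cong q
    ; conj-+          = λ (a , b) (c , d) → refl , sym (-‿+-comm b d)
    ; conj-*          = λ (a , b) (c , d) →
        solve 4 (λ a b c d → a :* c :- b :* d := a :* c :- :- b :* :- d) refl a b c d ,
        solve 4 (λ a b c d → :- (a :* d :+ b :* c) := a :* :- d :+ :- b :* c) refl a b c d
    ; conj-involutive = λ (a , b) → refl , -‿involutive b
    ; re-cong         = proj₁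
    ; re-+            = λ _ _ → refl
    ; re-x*conjx      = λ (a , b) →
        solve 2 (λ a b → a :* a :- b :* :- b := a :* a :+ b :* b) refl a b
    ; normSq-*        = λ (a , b) (c , d) →
        solve 4 (λ a b c d →
          (a :* c :- b :* d) :* (a :* c :- b :* d) :+ (a :* d :+ b :* c) :* (a :* d :+ b :* c) :=
          (a :* a :+ b :* b) :* (c :* c :+ d :* d)) refl a b c d
    ; normSq-+        = λ (a , b) (c , d) → ≤.≤-respʳ-≈
        (solve 4 (λ a b c d →
          ((a :+ c) :+ (a :+ c)) :+ ((b :+ d) :+ (b :+ d)) :=
          ((a :+ b) :+ (c :+ d)) :+ ((a :+ b) :+ (c :+ d))) refl (a * a) (b * b) (c * c) (d * d))
        (+-mono-≤ (square-+ a c) (square-+ b d))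
    ; normSq-nonNeg   = λ (a , b) → +-nonNegative (square-nonNegative a) (square-nonNegative b)
    ; normSq-def      = λ {(a , b)} e →
        x*x+y*y≈0⇒x≈0 {a} {b} e , x*x+y*y≈0⇒x≈0 {b} {a} (trans (+-comm (b * b) (a * a)) e)
    ; absolute-root   = complex-root
    }
    where
    module C = CommutativeRing (complexRing R)

    complex-inverse : ∀ z → ¬ z C.≈ C.0# → ∃[ w ] (z C.* w) C.≈ C.1#
    complex-inverse (a , b) z≉0 =
      let N≉0 = λ e → z≉0 (x*x+y*y≈0⇒x≈0 {a} {b} e ,
                           x*x+y*y≈0⇒x≈0 {b} {a} (trans (+-comm (b * b) (a * a)) e))
          M , NM≈1 = inverse (a * a +ʳ b * b) N≉0
      in (a * M , - (b * M)) ,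
         trans (solve 3 (λ a b M → a :* (a :* M) :- b :* :- (b :* M) :=
                                   (a :* a :+ b :* b) :* M) refl a b M) NM≈1 ,
         solve 3 (λ a b M → a :* :- (b :* M) :+ b :* (a :* M) := con (0 , 0)) refl a b M

    complex-root : ∀ z → (proj₁ z , - proj₂ z) C.≈ z → 0# ≤ʳ proj₁ z →
                   ∃[ s ] (s C.* (proj₁ s , - proj₂ s)) C.≈ z
    complex-root (a , b) (_ , -b≈b) 0≤a =
      -- A self-conjugate number has imaginary part zero, so a real root suffices.
      let s , ss≈a = square-root a 0≤a
      in (s , 0#) ,
         trans (solve 1 (λ s → s :* s :- con (0 , 0) :* :- con (0 , 0) := s :* s) refl s) ss≈a ,
         trans (solve 1 (λ s → s :* :- con (0 , 0) :+ con (0 , 0) :* s := con (0 , 0)) refl s)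
               (sym (-x≈x⇒x≈0 -b≈b))

scalars-isStarField : ∀ R 𝔽 → IsStarField (scalars R 𝔽)
scalars-isStarField R real    = real-isStarField R
scalars-isStarField R complex = complex-isStarField R

-- Orthonormalisation

module StarField {R : RealNumbers} (K : Scalars R) (isStarField : IsStarField K) where
  open Scalars K public hiding (zero)
  open IsStarField isStarField public
  open Field commutativeRing inverse public
  open IntegerSolver commutativeRing public
  open SemiringSum semiring public
    using (sum; sum-cong-≋; *-distribˡ-sum; *-distribʳ-sum; ∑-comm; ∑-distrib-+; sum-remove)
  open RingProperties ring public using (-0#≈0#)

  sum-zero : ∀ {n} {t : Fin n → Carrier} → (∀ i → t i ≈ 0#) → sum t ≈ 0#
  sum-zero {zero}  p = refl
  sum-zero {suc n} p = trans (+-cong (p zero) (sum-zero (p ∘ suc))) (+-identityˡ 0#)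

  sum-single : ∀ {n} {t : Fin n → Carrier} l → (∀ k → k ≢ l → t k ≈ 0#) → sum t ≈ t l
  sum-single {suc n} {t} l p = trans (sum-remove {i = l} t)
    (trans (+-congˡ (sum-zero (λ k → p (punchIn l k) (Fin.punchInᵢ≢i l k)))) (+-identityʳ (t l)))

  conj-0 : conj 0# ≈ 0#
  conj-0 = conj-zero refl

  conj-1 : conj 1# ≈ 1#
  conj-1 = begin
    conj 1#                     ≈⟨ *-identityʳ _ ⟨
    conj 1# * 1#                ≈⟨ *-congˡ (conj-involutive 1#) ⟨
    conj 1# * conj (conj 1#)    ≈⟨ conj-* 1# (conj 1#) ⟨
    conj (1# * conj 1#)         ≈⟨ conj-cong (*-identityˡ _) ⟩
    conj (conj 1#)              ≈⟨ conj-involutive 1# ⟩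
    1#                          ∎
    where open SetoidReasoning setoid

  conj-sum : ∀ {n} (t : Fin n → Carrier) → conj (sum t) ≈ sum (λ i → conj (t i))
  conj-sum {zero}  t = conj-0
  conj-sum {suc n} t = trans (conj-+ _ _) (+-congˡ (conj-sum (t ∘ suc)))

  -- Gaussian elimination on fewer equations than unknowns. If the first column vanishes, the first
  -- unknown is free. Otherwise row `p` eliminates it; scaling the other rows and unknowns by the
  -- pivot `a` avoids division.
  homogeneous : ∀ {d r} → r < d → (M : Fin r → Fin d → Carrier) →
    Σ[ c ∈ (Fin d → Carrier) ] (∃[ k ] ¬ c k ≈ 0#) × (∀ i → sum (λ k → c k * M i k) ≈ 0#)
  homogeneous {suc d} {r} (s≤s r≤d) M with Fin.any? (λ i → ¬? (M i zero ≟ 0#))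
  ... | no ∄pivot = 1# ∷ (λ _ → 0#) , (zero , λ 1≈0 → 0≉1 (sym 1≈0)) , λ i →
    trans (+-cong (*-identityˡ _) (sum-zero (λ k → zeroˡ (M i (suc k)))))
          (trans (+-identityʳ _) (decidable-stable (M i zero ≟ 0#) (λ ≉0 → ∄pivot (i , ≉0))))
  homogeneous {suc d} {suc r} (s≤s r<d) M | yes (p , a≉0) =
    let c , (k , ck≉0) , solves = homogeneous r<d M′
    in  solution c , (suc k , ≉0-* a≉0 ck≉0) , λ i → check c solves i (i Fin.≟ p)
    where
    a : Carrier
    a = M p zero

    M′ : Fin r → Fin d → Carrier
    M′ j k = a * M (punchIn p j) (suc k) - M (punchIn p j) zero * M p (suc k)

    solution : (Fin d → Carrier) → Fin (suc d) → Carrier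
    solution c = - sum (λ k → c k * M p (suc k)) ∷ (λ k → a * c k)

    expand : ∀ c i → sum (λ k → solution c k * M i k) ≈
      sum (λ k → c k * (a * M i (suc k) - M i zero * M p (suc k)))
    expand c i = begin
      - sum (λ k → c k * M p (suc k)) * M i zero + sum (λ k → a * c k * M i (suc k))
        ≈⟨ +-congʳ (solve 2 (λ s m → :- s :* m := :- m :* s) refl _ (M i zero)) ⟩
      - M i zero * sum (λ k → c k * M p (suc k)) + sum (λ k → a * c k * M i (suc k))
        ≈⟨ +-congʳ (*-distribˡ-sum (- M i zero) (λ k → c k * M p (suc k))) ⟩
      sum (λ k → - M i zero * (c k * M p (suc k))) + sum (λ k → a * c k * M i (suc k))
        ≈⟨ ∑-distrib-+ {d} _ _ ⟨
      sum (λ k → - M i zero * (c k * M p (suc k)) + a * c k * M i (suc k))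
        ≈⟨ sum-cong-≋ (λ k → solve 5 (λ m c q a n →
             :- m :* (c :* q) :+ a :* c :* n := c :* (a :* n :- m :* q))
             refl (M i zero) (c k) (M p (suc k)) a (M i (suc k))) ⟩
      sum (λ k → c k * (a * M i (suc k) - M i zero * M p (suc k))) ∎
      where open SetoidReasoning setoid

    check : ∀ c → (∀ j → sum (λ k → c k * M′ j k) ≈ 0#) →
            ∀ i → Dec (i ≡ p) → sum (λ k → solution c k * M i k) ≈ 0#
    check c solves i (yes ≡.refl) = trans (expand c i)
      (sum-zero (λ k → trans (*-congˡ (-‿inverseʳ _)) (zeroʳ (c k))))
    check c solves i (no i≢p) = trans (expand c i)
      (≡.subst (λ i → sum (λ k → c k * (a * M i (suc k) - M i zero * M p (suc k))) ≈ 0#)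
        (Fin.punchIn-punchOut (λ p≡i → i≢p (≡.sym p≡i))) (solves _))

  module InnerProduct (V : InnerProductSpace K) where
    open InnerProductSpace V public

    ⟨⟩-zeroˡ : ∀ y → ⟨ 0ᴹ , y ⟩ ≈ 0#
    ⟨⟩-zeroˡ y = trans (⟨⟩-cong (≈ᴹ-sym (*ₗ-zeroˡ 0ᴹ)) ≈ᴹ-refl) (trans (⟨⟩-*ˡ 0# 0ᴹ y) (zeroˡ _))

    orthogonal-sym : ∀ {x y} → ⟨ x , y ⟩ ≈ 0# → ⟨ y , x ⟩ ≈ 0#
    orthogonal-sym {x} {y} e = trans (⟨⟩-conj x y) (conj-zero e)

    ⟨⟩-+ʳ : ∀ x y z → ⟨ x , y +ᴹ z ⟩ ≈ ⟨ x , y ⟩ + ⟨ x , z ⟩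
    ⟨⟩-+ʳ x y z = begin
      ⟨ x , y +ᴹ z ⟩                   ≈⟨ ⟨⟩-conj _ _ ⟩
      conj ⟨ y +ᴹ z , x ⟩              ≈⟨ conj-cong (⟨⟩-+ˡ y z x) ⟩
      conj (⟨ y , x ⟩ + ⟨ z , x ⟩)     ≈⟨ conj-+ _ _ ⟩
      conj ⟨ y , x ⟩ + conj ⟨ z , x ⟩  ≈⟨ +-cong (⟨⟩-conj y x) (⟨⟩-conj z x) ⟨
      ⟨ x , y ⟩ + ⟨ x , z ⟩            ∎
      where open SetoidReasoning setoid

    ⟨⟩-*ʳ : ∀ a x y → ⟨ x , a *ₗ y ⟩ ≈ conj a * ⟨ x , y ⟩
    ⟨⟩-*ʳ a x y = begin
      ⟨ x , a *ₗ y ⟩            ≈⟨ ⟨⟩-conj _ _ ⟩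
      conj ⟨ a *ₗ y , x ⟩       ≈⟨ conj-cong (⟨⟩-*ˡ a y x) ⟩
      conj (a * ⟨ y , x ⟩)      ≈⟨ conj-* _ _ ⟩
      conj a * conj ⟨ y , x ⟩   ≈⟨ *-congˡ (⟨⟩-conj y x) ⟨
      conj a * ⟨ x , y ⟩        ∎
      where open SetoidReasoning setoid

    ⟨⟩-combination : ∀ {n} (c : Fin n → Carrier) (e : Fin n → Carrierᴹ) y →
      ⟨ combination c e , y ⟩ ≈ sum (λ k → c k * ⟨ e k , y ⟩)
    ⟨⟩-combination {zero}  c e y = ⟨⟩-zeroˡ y
    ⟨⟩-combination {suc n} c e y = trans (⟨⟩-+ˡ _ _ y)
      (+-cong (⟨⟩-*ˡ _ _ y) (⟨⟩-combination (c ∘ suc) (e ∘ suc) y))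

    record Orthonormal {p} (e : Fin p → Carrierᴹ) : Set where
      field
        unit       : ∀ k → ⟨ e k , e k ⟩ ≈ 1#
        orthogonal : ∀ {k l} → k ≢ l → ⟨ e k , e l ⟩ ≈ 0#

    open Orthonormal public

    -- Parseval's form of the statement that x lies in the span of e.
    Expands : ∀ {p} → (Fin p → Carrierᴹ) → Carrierᴹ → Set
    Expands e x = ∀ y → ⟨ x , y ⟩ ≈ sum (λ k → ⟨ x , e k ⟩ * ⟨ e k , y ⟩)

    record OrthonormalSpan {n} (f : Fin n → Carrierᴹ) : Set where
      field
        {size}      : ℕ
        size≤       : size ≤ n
        e           : Fin size → Carrierᴹ
        orthonormal : Orthonormal e
        expands     : ∀ i → Expands e (f i)
        -- Every e k lies in the span of f.
        annihilated : ∀ y → (∀ i → ⟨ f i , y ⟩ ≈ 0#) → ∀ k → ⟨ e k , y ⟩ ≈ 0#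

    -- Each vector is reduced modulo the later ones and dropped if nothing remains, so `size` is the
    -- dimension of the span.
    gram-schmidt : ∀ {n} (f : Fin n → Carrierᴹ) → OrthonormalSpan f
    gram-schmidt {zero}  f = record
      { size≤ = z≤n ; e = λ () ; orthonormal = record { unit = λ () ; orthogonal = λ {k} → case k of λ () }
      ; expands = λ () ; annihilated = λ _ _ () }
    gram-schmidt {suc n} f = extend (⟨ u , u ⟩ ≟ 0#)
      where
      open OrthonormalSpan (gram-schmidt (f ∘ suc))
      x u : Carrierᴹ
      x = f zero
      u = x +ᴹ combination (λ k → - ⟨ x , e k ⟩) e

      ⟨u,_⟩ : ∀ y → ⟨ u , y ⟩ ≈ ⟨ x , y ⟩ + sum (λ k → - ⟨ x , e k ⟩ * ⟨ e k , y ⟩)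
      ⟨u, y ⟩ = trans (⟨⟩-+ˡ _ _ y) (+-congˡ (⟨⟩-combination _ e y))

      decompose : ∀ y → ⟨ x , y ⟩ ≈ ⟨ u , y ⟩ + sum (λ k → ⟨ x , e k ⟩ * ⟨ e k , y ⟩)
      decompose y = begin
        ⟨ x , y ⟩           ≈⟨ +-identityʳ _ ⟨
        ⟨ x , y ⟩ + 0#      ≈⟨ +-congˡ (trans (sym (∑-distrib-+ {size} _ _)) (sum-zero (λ k →
                                 solve 2 (λ a b → :- a :* b :+ a :* b := con (0 , 0)) refl ⟨ x , e k ⟩ ⟨ e k , y ⟩))) ⟨
        ⟨ x , y ⟩ + (sum (λ k → - ⟨ x , e k ⟩ * ⟨ e k , y ⟩) + sum (λ k → ⟨ x , e k ⟩ * ⟨ e k , y ⟩))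
                            ≈⟨ +-assoc _ _ _ ⟨
        _                   ≈⟨ +-congʳ ⟨u, y ⟩ ⟨
        ⟨ u , y ⟩ + sum (λ k → ⟨ x , e k ⟩ * ⟨ e k , y ⟩) ∎
        where open SetoidReasoning setoid

      u⊥e : ∀ l → ⟨ u , e l ⟩ ≈ 0#
      u⊥e l = begin
        ⟨ u , e l ⟩                                                 ≈⟨ ⟨u, e l ⟩ ⟩
        ⟨ x , e l ⟩ + sum (λ k → - ⟨ x , e k ⟩ * ⟨ e k , e l ⟩)
          ≈⟨ +-congˡ (sum-single l (λ k k≢l → trans (*-congˡ (orthogonal orthonormal k≢l)) (zeroʳ _))) ⟩
        ⟨ x , e l ⟩ + - ⟨ x , e l ⟩ * ⟨ e l , e l ⟩                  ≈⟨ +-congˡ (*-congˡ (unit orthonormal l)) ⟩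
        ⟨ x , e l ⟩ + - ⟨ x , e l ⟩ * 1#                            ≈⟨ +-congˡ (*-identityʳ _) ⟩
        ⟨ x , e l ⟩ - ⟨ x , e l ⟩                                   ≈⟨ -‿inverseʳ _ ⟩
        0#                                                         ∎
        where open SetoidReasoning setoid

      u-annihilated : ∀ y → (∀ i → ⟨ f i , y ⟩ ≈ 0#) → ⟨ u , y ⟩ ≈ 0#
      u-annihilated y f⊥y = trans ⟨u, y ⟩ (trans (+-cong (f⊥y zero) (sum-zero (λ k →
        trans (*-congˡ (annihilated y (f⊥y ∘ suc) k)) (zeroʳ _)))) (+-identityˡ 0#))

      extend : Dec (⟨ u , u ⟩ ≈ 0#) → OrthonormalSpan f
      extend (yes u≈0) = record
        { size≤ = ℕ.m≤n⇒m≤1+n size≤ ; e = e ; orthonormal = orthonormal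
        ; expands = λ
          { zero y    → trans (decompose y) (trans (+-congʳ (trans (⟨⟩-cong (⟨⟩-def u u≈0) ≈ᴹ-refl) (⟨⟩-zeroˡ y)))
                              (+-identityˡ _))
          ; (suc i) y → expands i y }
        ; annihilated = λ y f⊥y → annihilated y (f⊥y ∘ suc) }
      extend (no u≉0) with absolute-root ⟨ u , u ⟩ (sym (⟨⟩-conj u u)) (⟨⟩-nonNeg u)
      ... | s , ss̄≈uu with inverse s (λ s≈0 → u≉0 (trans (sym ss̄≈uu) (trans (*-congʳ s≈0) (zeroˡ _))))
      ... | t , st≈1 = record
        { size≤ = s≤s size≤ ; e = e₀ ∷ e
        ; orthonormal = record
          { unit = λ { zero → unit₀ ; (suc k) → unit orthonormal k }
          ; orthogonal = λ
            { {zero} {zero} 0≢0 → contradiction ≡.refl 0≢0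
            ; {zero} {suc l} _ → e₀⊥e l
            ; {suc k} {zero} _ → orthogonal-sym (e₀⊥e k)
            ; {suc k} {suc l} k≢l → orthogonal orthonormal (λ k≡l → k≢l (≡.cong suc k≡l)) } }
        ; expands = λ
          { zero y → trans (decompose y) (+-congʳ (expand₀ y))
          ; (suc i) y → trans (expands i y) (trans (sym (+-identityˡ _)) (+-congʳ (sym
              (trans (*-congʳ (trans (expands i e₀) (sum-zero (λ k →
                trans (*-congˡ (orthogonal-sym (e₀⊥e k))) (zeroʳ _))))) (zeroˡ _))))) }
        ; annihilated = λ
          { y f⊥y zero → trans (⟨⟩-*ˡ t u y) (trans (*-congˡ (u-annihilated y f⊥y)) (zeroʳ t))
          ; y f⊥y (suc k) → annihilated y (f⊥y ∘ suc) k } }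
        where
        open SetoidReasoning setoid
        e₀ : Carrierᴹ
        e₀ = t *ₗ u

        e₀⊥e : ∀ k → ⟨ e₀ , e k ⟩ ≈ 0#
        e₀⊥e k = trans (⟨⟩-*ˡ t u (e k)) (trans (*-congˡ (u⊥e k)) (zeroʳ t))

        ⟨u,e₀⟩ : ⟨ u , e₀ ⟩ ≈ s
        ⟨u,e₀⟩ = begin
          ⟨ u , e₀ ⟩             ≈⟨ ⟨⟩-*ʳ t u u ⟩
          conj t * ⟨ u , u ⟩     ≈⟨ *-congˡ ss̄≈uu ⟨
          conj t * (s * conj s)  ≈⟨ solve 3 (λ t̄ s s̄ → t̄ :* (s :* s̄) := s :* (s̄ :* t̄)) refl _ _ _ ⟩
          s * (conj s * conj t)  ≈⟨ *-congˡ (trans (sym (conj-* s t)) (trans (conj-cong st≈1) conj-1)) ⟩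
          s * 1#                 ≈⟨ *-identityʳ s ⟩
          s                      ∎

        unit₀ : ⟨ e₀ , e₀ ⟩ ≈ 1#
        unit₀ = begin
          ⟨ e₀ , e₀ ⟩    ≈⟨ ⟨⟩-*ˡ t u e₀ ⟩
          t * ⟨ u , e₀ ⟩ ≈⟨ *-congˡ ⟨u,e₀⟩ ⟩
          t * s          ≈⟨ *-comm t s ⟩
          s * t          ≈⟨ st≈1 ⟩
          1#             ∎

        expand₀ : ∀ y → ⟨ u , y ⟩ ≈ ⟨ x , e₀ ⟩ * ⟨ e₀ , y ⟩
        expand₀ y = begin
          ⟨ u , y ⟩                  ≈⟨ *-identityˡ _ ⟨
          1# * ⟨ u , y ⟩             ≈⟨ *-congʳ st≈1 ⟨
          s * t * ⟨ u , y ⟩          ≈⟨ *-assoc _ _ _ ⟩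
          s * (t * ⟨ u , y ⟩)        ≈⟨ *-cong (sym ⟨u,e₀⟩) (sym (⟨⟩-*ˡ t u y)) ⟩
          -- `x` and `u` differ by a combination of the old `e k`, all orthogonal to `e₀`.
          ⟨ u , e₀ ⟩ * ⟨ e₀ , y ⟩    ≈⟨ *-congʳ (trans (decompose e₀) (trans (+-congˡ (sum-zero (λ k →
                                        trans (*-congˡ (orthogonal-sym (e₀⊥e k))) (zeroʳ _)))) (+-identityʳ _))) ⟨
          ⟨ x , e₀ ⟩ * ⟨ e₀ , y ⟩    ∎

-- Representations and frames

module OrderedSum (R : RealNumbers) where
  open RealNumbers R hiding (zero)
  open OrderedField R
  open SemiringSum semiring using (sum)

  sum-nonNegative : ∀ {n} {t : Fin n → Carrier} → (∀ i → 0# ≤ʳ t i) → 0# ≤ʳ sum t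
  sum-nonNegative {zero}  p = ≤.refl
  sum-nonNegative {suc n} p = +-nonNegative (p zero) (sum-nonNegative (p ∘ suc))

  term≤sum : ∀ {n} {t : Fin n → Carrier} → (∀ i → 0# ≤ʳ t i) → ∀ i → t i ≤ʳ sum t
  term≤sum p zero    = x≤x+y (sum-nonNegative (p ∘ suc))
  term≤sum p (suc i) = ≤.trans (term≤sum (p ∘ suc) i)
    (≤.≤-respʳ-≈ (+-comm _ _) (x≤x+y (p zero)))

  sum≈0⇒term≈0 : ∀ {n} {t : Fin n → Carrier} → (∀ i → 0# ≤ʳ t i) → sum t ≈ 0# → ∀ i → t i ≈ 0#
  sum≈0⇒term≈0 p e i = ≤.antisym (≤.≤-respʳ-≈ e (term≤sum p i)) (p i)

  sum-mono-≤ : ∀ {n} {s t : Fin n → Carrier} → (∀ i → s i ≤ʳ t i) → sum s ≤ʳ sum t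
  sum-mono-≤ {zero}  p = ≤.refl
  sum-mono-≤ {suc n} p = +-mono-≤ (p zero) (sum-mono-≤ (p ∘ suc))

module Representations {R : RealNumbers} (K : Scalars R) (isStarField : IsStarField K) where
  private
    module R = RealNumbers R
    module Rᵒ = OrderedField R
    module Rˢ where
      open SemiringSum R.semiring public
      open OrderedSum R public
  open StarField K isStarField public

  re-0 : re 0# R.≈ R.0#
  re-0 = RingProperties.x+x≈x⇒x≈0 R.ring (re 0#) (R.trans (R.sym (re-+ 0# 0#)) (re-cong (+-identityˡ 0#)))

  re-sum : ∀ {n} (t : Fin n → Carrier) → re (sum t) R.≈ Rˢ.sum (λ i → re (t i))
  re-sum {zero}  t = re-0
  re-sum {suc n} t = R.trans (re-+ _ _) (R.+-congˡ (re-sum (t ∘ suc)))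

  normSq-cong : ∀ {x y} → x ≈ y → normSq x R.≈ normSq y
  normSq-cong {x} {y} p = R.trans (R.sym (re-x*conjx x))
    (R.trans (re-cong (*-cong p (conj-cong p))) (re-x*conjx y))

  normSq-0 : normSq 0# R.≈ R.0#
  normSq-0 = R.trans (R.sym (re-x*conjx 0#)) (R.trans (re-cong (zeroˡ _)) re-0)

  normSq-conj : ∀ x → normSq (conj x) R.≈ normSq x
  normSq-conj x = R.trans (R.sym (re-x*conjx (conj x))) (R.trans
    (re-cong (trans (*-congˡ (conj-involutive x)) (*-comm _ _))) (re-x*conjx x))

  standardProduct : ∀ {d} → (Fin d → Carrier) → (Fin d → Carrier) → Carrier
  standardProduct x y = sum (λ k → x k * conj (y k))

  re-standardProduct : ∀ {d} (x : Fin d → Carrier) →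
    re (standardProduct x x) R.≈ Rˢ.sum (λ k → normSq (x k))
  re-standardProduct {d} x = R.trans (re-sum {d} _) (Rˢ.sum-cong-≋ (λ k → re-x*conjx (x k)))

  space : ℕ → InnerProductSpace K
  space d = record
    { vectorSpace = record
      { Carrierᴹ = Fin d → Carrier
      ; _≈ᴹ_ = λ x y → ∀ k → x k ≈ y k
      ; _+ᴹ_ = λ x y k → x k + y k
      ; _*ₗ_ = λ a x k → a * x k
      ; 0ᴹ   = λ _ → 0#
      ; -ᴹ_  = λ x k → - x k
      ; isLeftModule = record
        { isLeftSemimodule = record
          { +ᴹ-isCommutativeMonoid = Pointwise.isCommutativeMonoid (Fin d) +-isCommutativeMonoid
          ; isPreleftSemimodule = record
            { *ₗ-cong      = λ p q k → *-cong p (q k)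
            ; *ₗ-zeroˡ     = λ x k → zeroˡ (x k)
            ; *ₗ-distribʳ  = λ x a b k → distribʳ (x k) a b
            ; *ₗ-identityˡ = λ x k → *-identityˡ (x k)
            ; *ₗ-assoc     = λ a b x k → *-assoc a b (x k)
            ; *ₗ-zeroʳ     = λ a k → zeroʳ a
            ; *ₗ-distribˡ  = λ a x y k → distribˡ a (x k) (y k)
            }
          }
        ; -ᴹ‿cong    = λ p k → -‿cong (p k)
        ; -ᴹ‿inverse = (λ x k → -‿inverseˡ (x k)) , (λ x k → -‿inverseʳ (x k))
        }
      }
    ; ⟨_,_⟩     = standardProduct
    ; ⟨⟩-cong   = λ p q → sum-cong-≋ (λ k → *-cong (p k) (conj-cong (q k)))
    ; ⟨⟩-+ˡ     = λ x y z → trans (sum-cong-≋ (λ k → distribʳ (conj (z k)) (x k) (y k)))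
                                  (∑-distrib-+ {d} _ _)
    ; ⟨⟩-*ˡ     = λ a x y → trans (sum-cong-≋ (λ k → *-assoc a (x k) (conj (y k))))
                                  (sym (*-distribˡ-sum {d} a _))
    ; ⟨⟩-conj   = λ x y → sym (trans (conj-sum {d} _) (sum-cong-≋ (λ k →
                    trans (conj-* _ _) (trans (*-congˡ (conj-involutive (y k))) (*-comm _ _)))))
    ; ⟨⟩-nonNeg = λ x → Rᵒ.0≤-resp (R.sym (re-standardProduct x))
                    (Rˢ.sum-nonNegative (λ k → normSq-nonNeg (x k)))
    ; ⟨⟩-def    = λ x e k → normSq-def (Rˢ.sum≈0⇒term≈0 (λ k → normSq-nonNeg (x k))
                    (R.trans (R.sym (re-standardProduct x)) (R.trans (re-cong e) re-0)) k)
    }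

  sum-split : ∀ m {n} (t : Fin (m ℕ.+ n) → Carrier) →
              sum t ≈ sum (λ i → t (i ↑ˡ n)) + sum (λ j → t (m ↑ʳ j))
  sum-split zero    t = sym (+-identityˡ _)
  sum-split (suc m) t = trans (+-congˡ (sum-split m (t ∘ suc))) (sym (+-assoc _ _ _))

  standardProduct-++ : ∀ {p q} (x x′ : Fin p → Carrier) (y y′ : Fin q → Carrier) →
    standardProduct (x ++ y) (x′ ++ y′) ≈ standardProduct x x′ + standardProduct y y′
  standardProduct-++ {p} {q} x x′ y y′ = trans (sum-split p _) (+-cong
    (sum-cong-≋ (λ i → reflexive (≡.cong₂ (λ a b → a * conj b) (lookup-++ˡ x y i) (lookup-++ˡ x′ y′ i))))
    (sum-cong-≋ (λ j → reflexive (≡.cong₂ (λ a b → a * conj b) (lookup-++ʳ x y j) (lookup-++ʳ x′ y′ j)))))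

  module Space (d : ℕ) = InnerProduct (space d)

  Represents : ∀ (V : InnerProductSpace K) {n} → Graph n →
               (Fin n → InnerProductSpace.Carrierᴹ V) → Set
  Represents V G φ = ∀ {i j} → i ≢ j → Graph.Adj G i j ⇔ (¬ ⟨ φ i , φ j ⟩ ≈ 0#)
    where open InnerProductSpace V

  Rep : ℕ → ∀ {n} → Graph n → Set
  Rep d {n} G = Σ[ φ ∈ (Fin n → Fin d → Carrier) ] Represents (space d) G φ

  ≉0-resp : ∀ {x y} → x ≈ y → (¬ x ≈ 0#) ⇔ (¬ y ≈ 0#)
  ≉0-resp x≈y = mk⇔ (λ h y≈0 → h (trans x≈y y≈0)) (λ h x≈0 → h (trans (sym x≈y) x≈0))

  ⇔-trans : ∀ {A B C : Set} → A ⇔ B → B ⇔ C → A ⇔ C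
  ⇔-trans f g = mk⇔ (Equivalence.to g ∘ Equivalence.to f) (Equivalence.from f ∘ Equivalence.from g)

  pad : ∀ {p d n} (G : Graph n) → p ≤ d → Rep p G → Rep d G
  pad {p} G p≤d (φ , represents) with ℕ.m≤n⇒∃[o]m+o≡n p≤d
  ... | q , ≡.refl = (λ i → φ i ++ (λ (_ : Fin q) → 0#)) , λ {i} {j} i≢j →
    ⇔-trans (represents i≢j) (≉0-resp (sym (trans (standardProduct-++ (φ i) (φ j) _ _)
      (trans (+-congˡ (sum-zero {q} (λ _ → zeroˡ _))) (+-identityʳ _)))))

  module _ (V : InnerProductSpace K) where
    open InnerProduct V

    coordinates : ∀ {p} → (Fin p → Carrierᴹ) → Carrierᴹ → Fin p → Carrier
    coordinates e x k = ⟨ x , e k ⟩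

    coordinates-product : ∀ {p} {e : Fin p → Carrierᴹ} x y → Expands e x →
      standardProduct (coordinates e x) (coordinates e y) ≈ ⟨ x , y ⟩
    coordinates-product {e = e} x y expands = trans
      (sum-cong-≋ (λ k → *-congˡ (sym (⟨⟩-conj y (e k))))) (sym (expands y))

    -- Parseval's identity is linear in the expanded vector, so it passes from the `f i` to their
    -- span.
    expands-combination : ∀ {p n} {e : Fin p → Carrierᴹ} {f : Fin n → Carrierᴹ} →
      (∀ i → Expands e (f i)) → ∀ c {x} → combination c f ≈ᴹ x → Expands e x
    expands-combination {p} {n} {e} {f} expands c {x} cf≈x y = begin
      ⟨ x , y ⟩                                                    ≈⟨ along y ⟩
      sum (λ i → c i * ⟨ f i , y ⟩)
        ≈⟨ sum-cong-≋ (λ i → trans (*-congˡ (expands i y)) (trans (*-distribˡ-sum {p} (c i) _)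
             (sum-cong-≋ {p} (λ k → sym (*-assoc _ _ _))))) ⟩
      sum (λ i → sum (λ k → c i * ⟨ f i , e k ⟩ * ⟨ e k , y ⟩))     ≈⟨ ∑-comm {n} {p} _ ⟩
      sum (λ k → sum (λ i → c i * ⟨ f i , e k ⟩ * ⟨ e k , y ⟩))
        ≈⟨ sum-cong-≋ (λ k → *-distribʳ-sum ⟨ e k , y ⟩ (λ i → c i * ⟨ f i , e k ⟩)) ⟨
      sum (λ k → sum (λ i → c i * ⟨ f i , e k ⟩) * ⟨ e k , y ⟩)     ≈⟨ sum-cong-≋ (λ k → *-congʳ (along (e k))) ⟨
      sum (λ k → ⟨ x , e k ⟩ * ⟨ e k , y ⟩)                         ∎
      where
      open SetoidReasoning setoid
      along : ∀ y → ⟨ x , y ⟩ ≈ sum (λ i → c i * ⟨ f i , y ⟩)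
      along y = trans (⟨⟩-cong (≈ᴹ-sym cf≈x) ≈ᴹ-refl) (⟨⟩-combination c f y)

    -- `‖_‖²` sees only the real part. Writing `⟨ x , x ⟩` as `s * conj s` makes that real part
    -- `normSq s`, which is definite.
    ‖x‖²≈0⇒x≈0 : ∀ x → ‖ x ‖² R.≈ R.0# → x ≈ᴹ 0ᴹ
    ‖x‖²≈0⇒x≈0 x e with absolute-root ⟨ x , x ⟩ (sym (⟨⟩-conj x x)) (⟨⟩-nonNeg x)
    ... | s , ss̄≈xx = ⟨⟩-def x (trans (sym ss̄≈xx) (trans (*-congʳ s≈0) (zeroˡ _)))
      where
      s≈0 : s ≈ 0#
      s≈0 = normSq-def (R.trans (R.sym (re-x*conjx s)) (R.trans (re-cong ss̄≈xx) e))

    frame-complete : ∀ {N} {φ : Fin N → Carrierᴹ} → IsFrame φ →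
                     ∀ x → (∀ i → ⟨ x , φ i ⟩ ≈ 0#) → x ≈ᴹ 0ᴹ
    frame-complete {N} (A , _ , (0≤A , 0≉A) , _ , bounds) x x⊥φ = ‖x‖²≈0⇒x≈0 x
      (Rᶠ.x*y≈0⇒y≈0 (λ A≈0 → 0≉A (R.sym A≈0)) (Rᵒ.≤.antisym
        (Rᵒ.≤.≤-respʳ-≈ (R.trans (Rˢ.sum-cong-≋ (λ i → R.trans (normSq-cong (x⊥φ i)) normSq-0))
          (Rˢ.sum-replicate-zero N)) (proj₁ (bounds x)))
        (R.*-nonNegative 0≤A (⟨⟩-nonNeg x))))
      where module Rᶠ = Field R.commutativeRing R.inverse

    -- With fewer frame vectors than dimensions, some nonzero combination of the basis would be
    -- orthogonal to the whole frame.
    frame-size : ∀ {N d} {φ : Fin N → Carrierᴹ} → IsFrame φ → HasDimension d → d ≤ N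
    frame-size {N} {d} {φ} isFrame (b , isBasis) = ℕ.≮⇒≥ λ N<d →
      let c , (k , ck≉0) , solves = homogeneous N<d (λ i k → ⟨ b k , φ i ⟩)
      in  ck≉0 (IsBasis.independent isBasis c (frame-complete isFrame (combination c b)
            (λ i → trans (⟨⟩-combination c b (φ i)) (solves i))) k)

  -- Orthonormalising the basis `b`, not the frame, makes `size ≤ d` immediate, and padding supplies
  -- any missing coordinates.
  frame⇒rep : ∀ {d n} (G : Graph n) → IsFrameGraphInDim K d G → Rep d G × d ≤ n
  frame⇒rep {d} {n} G (V , (b , isBasis) , N , φ , isFrame , σ , adj⇔) =
    pad G size≤ (ψ , represents) ,
    ℕ.≤-trans (frame-size V isFrame (b , isBasis)) (Fin.injective⇒≤ (Injection.injective (↔⇒↣ σ)))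
    where
    open InnerProduct V
    open OrthonormalSpan (gram-schmidt b)

    ψ : Fin n → Fin size → Carrier
    ψ i = coordinates V e (φ (Inverse.from σ i))

    represents : Represents (space size) G ψ
    represents {i} {j} i≢j = mk⇔
      (λ a ≈0 → proj₂ (Equivalence.from (adj⇔ i′ j′)
        (≡.subst₂ (Graph.Adj G) (≡.sym (σσ⁻¹ i)) (≡.sym (σσ⁻¹ j)) a)) (trans (sym product) ≈0))
      (λ ≉0 → ≡.subst₂ (Graph.Adj G) (σσ⁻¹ i) (σσ⁻¹ j) (Equivalence.to (adj⇔ i′ j′)
        ((λ i′≡j′ → i≢j (≡.trans (≡.sym (σσ⁻¹ i)) (≡.trans (≡.cong (Inverse.to σ) i′≡j′) (σσ⁻¹ j)))) ,
         λ ≈0 → ≉0 (trans product ≈0))))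
      where
      i′ j′ : Fin N
      i′ = Inverse.from σ i
      j′ = Inverse.from σ j
      σσ⁻¹ : ∀ i → Inverse.to σ (Inverse.from σ i) ≡ i
      σσ⁻¹ = Inverse.strictlyInverseˡ σ
      product : standardProduct (ψ i) (ψ j) ≈ ⟨ φ i′ , φ j′ ⟩
      product with IsBasis.spanning isBasis (φ i′)
      ... | c , cb≈φ = coordinates-product V {e = e} (φ i′) (φ j′)
        (expands-combination V {e = e} expands c cb≈φ)

-- Spanning representations and explicit frame bounds

module Realisation {R : RealNumbers} (K : Scalars R) (isStarField : IsStarField K) where
  private
    module R = RealNumbers R
    module Rᵒ = OrderedField R
    module Rˢ where
      open SemiringSum R.semiring public
      open OrderedSum R public
  open Representations K isStarField public

  -- Orthogonality in the order `⟨ u , f i ⟩` is linear in `u`, with coefficients `conj (f i k)`;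
  -- the other order follows by symmetry.
  perpendicular : ∀ {d r} → r < d → (f : Fin r → Fin d → Carrier) →
    Σ[ u ∈ (Fin d → Carrier) ] (¬ standardProduct u u ≈ 0#) × (∀ i → standardProduct (f i) u ≈ 0#)
  perpendicular {d} r<d f with homogeneous r<d (λ i k → conj (f i k))
  ... | u , (k , uk≉0) , u⊥f =
    u , (λ uu≈0 → uk≉0 (InnerProductSpace.⟨⟩-def (space d) u uu≈0 k)) ,
    λ i → Space.orthogonal-sym d {u} {f i} (u⊥f i)

  dependent : ∀ {d p} → d < p → (f : Fin p → Fin d → Carrier) →
    Σ[ c ∈ (Fin p → Carrier) ] (∃[ k ] ¬ c k ≈ 0#) ×
      (∀ y → sum (λ k → c k * standardProduct (f k) y) ≈ 0#)
  dependent {d} {p} d<p f with homogeneous d<p (λ i k → f k i)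
  ... | c , c≉0 , solves = c , c≉0 , λ y → begin
    sum (λ k → c k * standardProduct (f k) y)
      ≈⟨ sum-cong-≋ (λ k → trans (*-distribˡ-sum {d} (c k) _)
           (sum-cong-≋ {d} (λ i → sym (*-assoc _ _ _)))) ⟩
    sum (λ k → sum (λ i → c k * f k i * conj (y i)))   ≈⟨ ∑-comm {p} {d} _ ⟩
    sum (λ i → sum (λ k → c k * f k i * conj (y i)))
      ≈⟨ sum-zero (λ i → trans (sym (*-distribʳ-sum (conj (y i)) (λ k → c k * f k i)))
           (trans (*-congʳ (solves i)) (zeroˡ _))) ⟩
    0# ∎
    where open SetoidReasoning setoid

  orthonormal-size : ∀ {d p} {e : Fin p → Fin d → Carrier} → Space.Orthonormal d e → p ≤ d
  orthonormal-size {d} {p} {e} orthonormal = ℕ.≮⇒≥ λ d<p →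
    let c , (l , cl≉0) , relation = dependent d<p e
    in  cl≉0 (trans (trans (sym (*-identityʳ (c l))) (trans (*-congˡ (sym (unit orthonormal l)))
          (sym (sum-single l (λ k k≢l → trans (*-congˡ (orthogonal orthonormal k≢l)) (zeroʳ (c k)))))))
          (relation (e l)))
    where open Space d

  -- Linear independence with the relation tested against every `y`, which is equivalent by
  -- definiteness and is the form in which relations are paired with vectors below.
  Independent : ∀ {d r} → (Fin r → Fin d → Carrier) → Set
  Independent {d} {r} f = ∀ (c : Fin r → Carrier) → (∀ (y : Fin d → Carrier) → sum (λ k → c k * standardProduct (f k) y) ≈ 0#) → ∀ k → c k ≈ 0#

  independent-cong : ∀ {d r} {f g : Fin r → Fin d → Carrier} → (∀ k → f k ≡ g k) →
                     Independent f → Independent g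
  independent-cong f≡g independent c relation = independent c (λ y →
    trans (sum-cong-≋ (λ k → reflexive (≡.cong (λ v → c k * standardProduct v y) (f≡g k)))) (relation y))

  -- Pairing a relation with `u` leaves only its first term.
  independent-extend : ∀ {d r} {f : Fin (suc r) → Fin d → Carrier} u →
    ¬ standardProduct (f zero) u ≈ 0# → (∀ k → standardProduct (f (suc k)) u ≈ 0#) →
    Independent (f ∘ suc) → Independent f
  independent-extend {d} {r} {f} u f₀u≉0 f⊥u independent c relation = λ
    { zero → c₀≈0
    ; (suc k) → independent (c ∘ suc) (λ y → trans (sym (+-identityˡ _))
        (trans (+-congʳ (sym (trans (*-congʳ c₀≈0) (zeroˡ _)))) (relation y))) k }
    where
    c₀≈0 : c zero ≈ 0#
    c₀≈0 = x*y≈0⇒y≈0 f₀u≉0 (trans (*-comm _ _) (trans (sym (+-identityʳ _))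
      (trans (+-congˡ (sym (sum-zero {r} (λ k → trans (*-congˡ (f⊥u k)) (zeroʳ _))))) (relation u))))

  outside-image : ∀ {r n} → r < n → (s : Fin r → Fin n) → ∃[ i ] (∀ k → s k ≢ i)
  outside-image r<n s with Fin.any? (λ i → ¬? (Fin.any? (λ k → s k Fin.≟ i)))
  ... | yes (i , ∄k) = i , λ k sk≡i → ∄k (k , sk≡i)
  ... | no  onto = contradiction (Fin.injective⇒≤ {f = λ i → proj₁ (preimage i)} (λ {i} {j} e →
          ≡.trans (≡.sym (proj₂ (preimage i))) (≡.trans (≡.cong s e) (proj₂ (preimage j)))))
          (ℕ.<⇒≱ r<n)
    where
    preimage : ∀ i → ∃[ k ] s k ≡ i
    preimage i = decidable-stable (Fin.any? (λ k → s k Fin.≟ i)) (λ ∄k → onto (i , ∄k))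

  module _ {n d : ℕ} (G : Graph n) where
    open Space d

    -- The decision is an argument so that proofs can match on it directly.
    add-if : ∀ (φ : Fin n → Carrierᴹ) (u : Carrierᴹ) {i j} → Dec (j ≡ i) → Carrierᴹ
    add-if φ u {i} {j} (yes _) = φ j +ᴹ u
    add-if φ u {i} {j} (no  _) = φ j

    add-if-represents : ∀ {φ u i} → (∀ j → ⟨ φ j , u ⟩ ≈ 0#) → Represents (space d) G φ →
      Represents (space d) G (λ j → add-if φ u (j Fin.≟ i))
    add-if-represents {φ} {u} {i} φ⊥u represents {a} {b} a≢b =
      ⇔-trans (represents a≢b) (≉0-resp (sym (go (a Fin.≟ i) (b Fin.≟ i))))
      where
      go : (p : Dec (a ≡ i)) (q : Dec (b ≡ i)) → ⟨ add-if φ u p , add-if φ u q ⟩ ≈ ⟨ φ a , φ b ⟩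
      go (yes ≡.refl) (yes ≡.refl) = contradiction ≡.refl a≢b
      go (yes _)      (no _)       = trans (⟨⟩-+ˡ (φ a) u (φ b))
        (trans (+-congˡ (orthogonal-sym {φ b} {u} (φ⊥u b))) (+-identityʳ _))
      go (no _)       (yes _)      = trans (⟨⟩-+ʳ (φ a) (φ b) u) (trans (+-congˡ (φ⊥u a)) (+-identityʳ _))
      go (no _)       (no _)       = refl

    -- A vector u orthogonal to the independent subfamily either detects a further
    -- independent member, or is orthogonal to all of φ; in the latter case adding
    -- it to one member outside the subfamily leaves all other inner products unchanged.
    grow : ∀ k r → r ℕ.+ k ≡ d → d ≤ n → (s : Fin r → Fin n) (φ : Fin n → Carrierᴹ) →
      Represents (space d) G φ → Independent (φ ∘ s) →
      Σ[ s ∈ (Fin d → Fin n) ] Σ[ φ ∈ (Fin n → Carrierᴹ) ]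
        Represents (space d) G φ × Independent (φ ∘ s)
    grow zero r r+0≡d d≤n s φ represents independent
      with ≡.trans (≡.sym (ℕ.+-identityʳ r)) r+0≡d
    ... | ≡.refl = s , φ , represents , independent
    grow (suc k) r r+1+k≡d d≤n s φ represents independent
      with r+1+k≡d′ ← ≡.trans (≡.sym (ℕ.+-suc r k)) r+1+k≡d
      with r<d ← ≡.subst (r <_) r+1+k≡d′ (ℕ.m≤m+n (suc r) k)
      with perpendicular r<d (φ ∘ s)
    ... | u , uu≉0 , φs⊥u with Fin.any? (λ i → ¬? (⟨ φ i , u ⟩ ≟ 0#))
    ... | yes (i , φi⊥̸u) = grow k (suc r) r+1+k≡d′ d≤n (i ∷ s) φ represents
            (independent-extend {f = φ ∘ (i ∷ s)} u φi⊥̸u φs⊥u independent)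
    -- This is where `d ≤ n` enters: fewer than `d` vertices are chosen, so one is left to absorb
    -- `u`.
    ... | no  φ⊥u′ with outside-image (ℕ.<-≤-trans r<d d≤n) s
    ... | i , s≢i = grow k (suc r) r+1+k≡d′ d≤n (i ∷ s) φ′ (add-if-represents φ⊥u represents)
            (independent-extend {f = φ′ ∘ (i ∷ s)} u
              (λ φ′i⊥u → uu≉0 (trans (sym (φ′i,u (i Fin.≟ i))) φ′i⊥u))
              (λ k → trans (reflexive (≡.cong (λ v → ⟨ v , u ⟩) (≡.sym (φ′s k (s k Fin.≟ i))))) (φs⊥u k))
              (independent-cong (λ k → φ′s k (s k Fin.≟ i)) independent))
      where
      φ′ : Fin n → Carrierᴹ
      φ′ j = add-if φ u (j Fin.≟ i)
      φ⊥u : ∀ j → ⟨ φ j , u ⟩ ≈ 0#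
      φ⊥u j = decidable-stable (⟨ φ j , u ⟩ ≟ 0#) (λ ≉0 → φ⊥u′ (j , ≉0))
      φ′s : ∀ k (p : Dec (s k ≡ i)) → φ (s k) ≡ add-if φ u p
      φ′s k (yes sk≡i) = contradiction sk≡i (s≢i k)
      φ′s k (no _)     = ≡.refl
      φ′i,u : (p : Dec (i ≡ i)) → ⟨ add-if φ u p , u ⟩ ≈ ⟨ u , u ⟩
      φ′i,u (yes _)  = trans (⟨⟩-+ˡ (φ i) u u) (trans (+-congʳ (φ⊥u i)) (+-identityˡ _))
      φ′i,u (no i≢i) = contradiction ≡.refl i≢i

  -- A crude Cauchy-Schwarz inequality: induction with `|x + y|² ≤ 2 (|x|² + |y|²)` gives a constant
  -- that depends on the coefficients `c` alone.
  dominate : ∀ {r} (c : Fin r → Carrier) → ∃[ C ] R.0# R.≤ʳ C ×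
    (∀ (z : Fin r → Carrier) {S} → (∀ k → normSq (z k) R.≤ʳ S) → normSq (sum (λ k → c k * z k)) R.≤ʳ (C R.* S))
  dominate {zero}  c = R.0# , Rᵒ.≤.refl , λ _ _ →
    Rᵒ.≤.reflexive (R.trans normSq-0 (R.sym (R.zeroˡ _)))
  dominate {suc r} c with dominate (c ∘ suc)
  ... | C , 0≤C , bound = N R.+ʳ N , Rᵒ.+-nonNegative 0≤N 0≤N , λ z {S} z≤S →
    let step : (normSq (c zero * z zero) R.+ʳ normSq (sum (λ k → c (suc k) * z (suc k)))) R.≤ʳ (N R.* S)
        step = Rᵒ.≤.≤-respʳ-≈ (R.sym (R.distribʳ S _ C)) (Rᵒ.+-mono-≤
          (Rᵒ.≤.≤-respˡ-≈ (R.sym (normSq-* _ _)) (Rᵒ.*-monoʳ-≤ (normSq-nonNeg (c zero)) (z≤S zero)))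
          (bound (z ∘ suc) (z≤S ∘ suc)))
    in  Rᵒ.≤.trans (normSq-+ _ _) (Rᵒ.≤.≤-respʳ-≈ (R.sym (R.distribʳ S N N)) (Rᵒ.+-mono-≤ step step))
    where
    N : R.Carrier
    N = normSq (c zero) R.+ʳ C
    0≤N : R.0# R.≤ʳ N
    0≤N = Rᵒ.+-nonNegative (normSq-nonNeg (c zero)) 0≤C

  module _ {d : ℕ} where
    open Space d

    standardBasis : Fin d → Carrierᴹ
    standardBasis i k with i Fin.≟ k
    ... | yes _ = 1#
    ... | no  _ = 0#

    standardBasis-diagonal : ∀ i → standardBasis i i ≈ 1#
    standardBasis-diagonal i with i Fin.≟ i
    ... | yes _   = refl
    ... | no  i≢i = contradiction ≡.refl i≢i

    standardBasis-off : ∀ {i k} → i ≢ k → standardBasis i k ≈ 0#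
    standardBasis-off {i} {k} i≢k with i Fin.≟ k
    ... | yes i≡k = contradiction i≡k i≢k
    ... | no  _   = refl

    standardBasis-product : ∀ i (y : Carrierᴹ) → ⟨ standardBasis i , y ⟩ ≈ conj (y i)
    standardBasis-product i y = trans
      (sum-single i (λ k k≢i → trans (*-congʳ (standardBasis-off (λ i≡k → k≢i (≡.sym i≡k)))) (zeroˡ _)))
      (trans (*-congʳ (standardBasis-diagonal i)) (*-identityˡ _))

    combination-at : ∀ {r} c (e : Fin r → Carrierᴹ) k → combination c e k ≈ sum (λ i → c i * e i k)
    combination-at {zero}  c e k = refl
    combination-at {suc r} c e k = +-congˡ (combination-at (c ∘ suc) (e ∘ suc) k)

    combination-standardBasis : ∀ c → combination c standardBasis ≈ᴹ c
    combination-standardBasis c k = trans (combination-at c standardBasis k) (trans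
      (sum-single k (λ i i≢k → trans (*-congˡ (standardBasis-off i≢k)) (zeroʳ _)))
      (trans (*-congˡ (standardBasis-diagonal k)) (*-identityʳ _)))

    standardBasis-isBasis : IsBasis standardBasis
    standardBasis-isBasis = record
      { independent = λ c e k → trans (sym (combination-standardBasis c k)) (e k)
      ; spanning    = λ x → x , combination-standardBasis x }

    module _ {N : ℕ} (φ : Fin N → Carrierᴹ) where
      energy : Carrierᴹ → R.Carrier
      energy y = Rˢ.sum (λ i → normSq ⟨ y , φ i ⟩)

      normSq-swap : ∀ x y → normSq ⟨ x , y ⟩ R.≈ normSq ⟨ y , x ⟩
      normSq-swap x y = R.trans (normSq-cong (⟨⟩-conj y x)) (normSq-conj _)

      term≤energy : ∀ y i → normSq ⟨ φ i , y ⟩ R.≤ʳ energy y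
      term≤energy y i = Rᵒ.≤.≤-respˡ-≈ (normSq-swap y (φ i))
        (Rˢ.term≤sum (λ i → normSq-nonNeg ⟨ y , φ i ⟩) i)

      -- Each `⟨ y , φ i ⟩` is a fixed combination of the coordinates of `y`, and no coordinate
      -- exceeds the norm.
      upper-bound : ∃[ B ] R.0# R.≤ʳ B × (∀ y → energy y R.≤ʳ (B R.* ‖ y ‖²))
      upper-bound = Rˢ.sum (λ i → proj₁ (C i)) , Rˢ.sum-nonNegative (λ i → proj₁ (proj₂ (C i))) , λ y →
        Rᵒ.≤.≤-respʳ-≈ (R.sym (Rˢ.*-distribʳ-sum ‖ y ‖² (λ i → proj₁ (C i))))
          (Rˢ.sum-mono-≤ (λ i → Rᵒ.≤.≤-respˡ-≈
            (normSq-cong (sum-cong-≋ {d} (λ k → *-comm _ _)))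
            (proj₂ (proj₂ (C i)) y (λ k → Rᵒ.≤.≤-respʳ-≈ (R.sym (re-standardProduct y))
              (Rˢ.term≤sum (λ k → normSq-nonNeg (y k)) k)))))
        where
        C : ∀ i → ∃[ C ] R.0# R.≤ʳ C × (∀ (z : Fin d → Carrier) {S} → (∀ k → normSq (z k) R.≤ʳ S) →
                                        normSq (sum (λ k → conj (φ i k) * z k)) R.≤ʳ (C R.* S))
        C i = dominate (λ k → conj (φ i k))

      -- The independent `φ (s k)` span, so each `conj (y j)` is a fixed combination of the
      -- `⟨ φ (s k) , y ⟩`, and these are dominated by the energy.
      lower-bound : {s : Fin d → Fin N} → Independent (φ ∘ s) →
                    ∃[ C ] R.0# R.≤ʳ C × (∀ y → ‖ y ‖² R.≤ʳ (C R.* energy y))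
      lower-bound {s} independent =
        Rˢ.sum (λ j → proj₁ (C j)) , Rˢ.sum-nonNegative (λ j → proj₁ (proj₂ (C j))) , λ y →
        Rᵒ.≤.≤-respˡ-≈ (R.sym (re-standardProduct y))
          (Rᵒ.≤.≤-respʳ-≈ (R.sym (Rˢ.*-distribʳ-sum (energy y) (λ j → proj₁ (C j))))
            (Rˢ.sum-mono-≤ (λ j → proj₂ (proj₂ (C j)) y)))
        where
        C : ∀ j → ∃[ C ] R.0# R.≤ʳ C × (∀ y → normSq (y j) R.≤ʳ (C R.* energy y))
        -- `d + 1` vectors of 𝔽ᵈ are dependent, and independence of the last `d` makes the
        -- coefficient of `standardBasis j` nonzero.
        C j with dependent (ℕ.n<1+n d) (standardBasis j ∷ (φ ∘ s))
        ... | c , (k , ck≉0) , relation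
            with inverse (c zero) (λ c₀≈0 → ck≉0 (all-zero c₀≈0 k))
          where
          all-zero : c zero ≈ 0# → ∀ k → c k ≈ 0#
          all-zero c₀≈0 zero    = c₀≈0
          all-zero c₀≈0 (suc k) = independent (c ∘ suc) (λ y → trans (sym (+-identityˡ _))
            (trans (+-congʳ (sym (trans (*-congʳ c₀≈0) (zeroˡ _)))) (relation y))) k
        ... | a , c₀a≈1 with dominate (λ k → - (a * c (suc k)))
        ... | C , 0≤C , bound = C , 0≤C , λ y → Rᵒ.≤.≤-respˡ-≈
          (R.trans (normSq-cong (sym (expansion y))) (normSq-conj (y j)))
          (bound (λ k → ⟨ φ (s k) , y ⟩) (λ k → term≤energy y (s k)))
          where
          open SetoidReasoning setoid
          expansion : ∀ y → conj (y j) ≈ sum (λ k → - (a * c (suc k)) * ⟨ φ (s k) , y ⟩)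
          expansion y = begin
            conj (y j)                            ≈⟨ standardBasis-product j y ⟨
            ⟨ standardBasis j , y ⟩               ≈⟨ *-identityˡ _ ⟨
            1# * ⟨ standardBasis j , y ⟩          ≈⟨ *-congʳ c₀a≈1 ⟨
            c zero * a * ⟨ standardBasis j , y ⟩  ≈⟨ solve 4 (λ c₀ a e s →
              c₀ :* a :* e := a :* (c₀ :* e :+ s) :+ :- a :* s) refl (c zero) a (⟨ standardBasis j , y ⟩) rest ⟩
            a * (c zero * ⟨ standardBasis j , y ⟩ + rest) + - a * rest
                                                  ≈⟨ +-congʳ (trans (*-congˡ (relation y)) (zeroʳ a)) ⟩
            0# + - a * rest                       ≈⟨ +-identityˡ _ ⟩
            - a * rest                            ≈⟨ *-distribˡ-sum {d} (- a) _ ⟩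
            sum (λ k → - a * (c (suc k) * ⟨ φ (s k) , y ⟩))
              ≈⟨ sum-cong-≋ (λ k → solve 3 (λ a c z → :- a :* (c :* z) := :- (a :* c) :* z) refl a (c (suc k)) (⟨ φ (s k) , y ⟩)) ⟩
            sum (λ k → - (a * c (suc k)) * ⟨ φ (s k) , y ⟩) ∎
            where
            rest : Carrier
            rest = sum (λ k → c (suc k) * ⟨ φ (s k) , y ⟩)

      bounds⇒frame : ∀ {A B C} → ((R.1# R.+ʳ C) R.* A) R.≈ R.1# → R.0# R.≤ʳ C → R.0# R.≤ʳ B →
        (∀ y → ‖ y ‖² R.≤ʳ (C R.* energy y)) → (∀ y → energy y R.≤ʳ (B R.* ‖ y ‖²)) → IsFrame φ
      bounds⇒frame {A} {B} DA≈1 0≤C 0≤B lower upper =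
        A , A R.+ʳ B , (0≤A , 0≉A) , Rᵒ.x≤x+y 0≤B , λ y →
        Rᵒ.invert-bound DA≈1 0≤A (Rˢ.sum-nonNegative (λ i → normSq-nonNeg ⟨ y , φ i ⟩)) (lower y) ,
        Rᵒ.weaken-bound 0≤A (⟨⟩-nonNeg y) (upper y)
        where
        0≤A : R.0# R.≤ʳ A
        0≤A = Rᵒ.inverse-nonNegative DA≈1 (Rᵒ.+-nonNegative Rᵒ.0≤1 0≤C)
        0≉A : ¬ R.0# R.≈ A
        0≉A 0≈A = R.0≉1 (R.trans (R.sym (R.zeroʳ _)) (R.trans (R.*-congˡ 0≈A) DA≈1))

      independent⇒frame : {s : Fin d → Fin N} → Independent (φ ∘ s) → IsFrame φ
      independent⇒frame {s} independent =
        let C , 0≤C , lower = lower-bound {s} independent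
            B , 0≤B , upper = upper-bound
            A , DA≈1        = R.inverse (R.1# R.+ʳ C) (Rᵒ.1+x≉0 0≤C)
        in  bounds⇒frame DA≈1 0≤C 0≤B lower upper

  rep⇒frame : ∀ {d n} (G : Graph n) → Rep d G → d ≤ n → IsFrameGraphInDim K d G
  rep⇒frame {d} {n} G (φ , represents) d≤n
    with grow G d 0 ≡.refl d≤n (λ ()) φ represents (λ _ _ ())
  ... | s , φ′ , represents′ , independent =
    space d , (standardBasis , standardBasis-isBasis) , n , φ′ , independent⇒frame φ′ {s} independent ,
    ↔-id (Fin n) , λ i j → mk⇔
      (λ (i≢j , ≉0) → Equivalence.from (represents′ i≢j) ≉0)
      (λ a → let i≢j = λ i≡j → Graph.irrefl G i≡j a in i≢j , Equivalence.to (represents′ i≢j) a)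

-- Constructions of representations

module Constructions {R : RealNumbers} (K : Scalars R) (isStarField : IsStarField K) where
  open Realisation K isStarField public

  module _ (V : InnerProductSpace K) where
    open InnerProduct V

    -- The index type is arbitrary so that joins and glued graphs can be treated on a disjoint sum,
    -- by cases on the two sides.
    Realises : ∀ {A : Set} → (A → A → Set) → (A → Carrierᴹ) → A → A → Set
    Realises _∼_ φ i j = (i ∼ j) ⇔ (¬ ⟨ φ i , φ j ⟩ ≈ 0#)

    realises-sym : ∀ {A : Set} {_∼_ : A → A → Set} {φ : A → Carrierᴹ} → (∀ {i j} → i ∼ j → j ∼ i) →
                   ∀ i j → Realises _∼_ φ i j → Realises _∼_ φ j i
    realises-sym symm i j r = mk⇔
      (λ a ≈0 → Equivalence.to r (symm a) (orthogonal-sym ≈0))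
      (λ ≉0 → symm (Equivalence.from r (λ ≈0 → ≉0 (orthogonal-sym ≈0))))

  module _ (V : InnerProductSpace K) where
    open InnerProduct V

    represents-induced : ∀ {n m} (G : Graph n) (H : Graph m) {φ : Fin n → Carrierᴹ}
      (τ : Fin m → Fin n) → Injective _≡_ _≡_ τ →
      (∀ {i j} → i ≢ j → Graph.Adj H i j ⇔ Graph.Adj G (τ i) (τ j)) →
      Represents V G φ → Represents V H (φ ∘ τ)
    represents-induced G H τ injective adj⇔ represents i≢j =
      ⇔-trans (adj⇔ i≢j) (represents (λ e → i≢j (injective e)))

    -- Projecting to the span of `e` preserves an inner product as soon as one of the two vectors
    -- lies in that span.
    represents-coordinates : ∀ {n p} (G : Graph n) {φ : Fin n → Carrierᴹ} (e : Fin p → Carrierᴹ) →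
      (∀ {i j} → i ≢ j → Expands e (φ i) ⊎ Expands e (φ j)) →
      Represents V G φ → Represents (space p) G (λ i → coordinates V e (φ i))
    represents-coordinates {p = p} G {φ} e expands represents {i} {j} i≢j with expands i≢j
    ... | inj₁ expands-i = ⇔-trans (represents i≢j)
            (≉0-resp (sym (coordinates-product V {e = e} (φ i) (φ j) expands-i)))
    ... | inj₂ expands-j = realises-sym (space p) {φ = λ i → coordinates V e (φ i)} (λ {i} {j} → Graph.symm G {i} {j}) j i
            (⇔-trans (represents (λ j≡i → i≢j (≡.sym j≡i)))
              (≉0-resp (sym (coordinates-product V {e = e} (φ j) (φ i) expands-j))))

    norm≉0 : ∀ {n} (G : Graph n) {φ : Fin n → Carrierᴹ} → Represents V G φ →
             ∀ {i j} → Graph.Adj G i j → ¬ ⟨ φ i , φ i ⟩ ≈ 0#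
    norm≉0 G {φ} represents {i} {j} a e = Equivalence.to (represents (λ i≡j → Graph.irrefl G i≡j a)) a
      (trans (⟨⟩-cong (⟨⟩-def (φ i) e) ≈ᴹ-refl) (⟨⟩-zeroˡ (φ j)))

  -- Needed because `IsJustFrameGraph` speaks only about positive dimensions.
  rep-edge⇒0< : ∀ {d n} (G : Graph n) → Rep d G → ∀ {i j} → Graph.Adj G i j → 1 ≤ d
  rep-edge⇒0< {zero}  G (φ , represents) a =
    contradiction refl (Equivalence.to (represents (λ i≡j → Graph.irrefl G i≡j a)) a)
  rep-edge⇒0< {suc d} G _ a = s≤s z≤n

  indicator : ∀ {P : Set} → Dec P → Carrier
  indicator (yes _) = 1#
  indicator (no _)  = 0#

  indicator-⇔ : ∀ {P : Set} (P? : Dec P) → P ⇔ (¬ indicator P? ≈ 0#)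
  indicator-⇔ (yes p) = mk⇔ (λ _ 1≈0 → 0≉1 (sym 1≈0)) (λ _ → p)
  indicator-⇔ (no ¬p) = mk⇔ (λ p → contradiction p ¬p) (λ ≉0 → contradiction refl ≉0)

  delete-first : ∀ {n} → Graph (suc n) → Graph n
  delete-first G = record
    { Adj    = λ i j → Graph.Adj G (suc i) (suc j)
    ; adj?   = λ i j → Graph.adj? G (suc i) (suc j)
    ; symm   = Graph.symm G
    ; irrefl = λ i≡j → Graph.irrefl G (≡.cong suc i≡j)
    }

  -- Spends one coordinate on each pair of vertices. The first vertex stores its adjacency row in
  -- `n` fresh coordinates, where the other vertices carry distinct standard basis vectors and so
  -- keep their mutual products.
  rep-exists : ∀ {n} (G : Graph n) → ∃[ d ] Rep d G
  rep-exists {zero}  G = 0 , (λ ()) , λ {i} → case i of λ ()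
  rep-exists {suc n} G with rep-exists (delete-first G)
  ... | d , φ , represents = d ℕ.+ n , Φ , realises
    where
    a : Fin n → Carrier
    a j = indicator (Graph.adj? G zero (suc j))

    Φ : Fin (suc n) → Fin (d ℕ.+ n) → Carrier
    Φ zero    = (λ _ → 0#) ++ a
    Φ (suc j) = φ j ++ standardBasis j

    first : ∀ j → Realises (space (d ℕ.+ n)) (Graph.Adj G) Φ zero (suc j)
    first j = ⇔-trans (indicator-⇔ (Graph.adj? G zero (suc j))) (≉0-resp (sym (begin
      standardProduct (Φ zero) (Φ (suc j))        ≈⟨ standardProduct-++ (λ _ → 0#) (φ j) a (standardBasis j) ⟩
      standardProduct {d} (λ _ → 0#) (φ j) + standardProduct a (standardBasis j)
        ≈⟨ +-cong (Space.⟨⟩-zeroˡ d (φ j)) (InnerProductSpace.⟨⟩-conj (space n) (standardBasis j) a) ⟩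
      0# + conj (standardProduct (standardBasis j) a)
        ≈⟨ trans (+-identityˡ _) (trans (conj-cong (standardBasis-product j a)) (conj-involutive (a j))) ⟩
      a j                                        ∎)))
      where open SetoidReasoning setoid

    realises : ∀ {i j} → i ≢ j → Realises (space (d ℕ.+ n)) (Graph.Adj G) Φ i j
    realises {zero}  {zero}  0≢0 = contradiction ≡.refl 0≢0
    realises {zero}  {suc j} _   = first j
    realises {suc i} {zero}  _   =
      realises-sym (space (d ℕ.+ n)) {φ = Φ} (λ {i} {j} → Graph.symm G {i} {j}) zero (suc i) (first i)
    realises {suc i} {suc j} i≢j = ⇔-trans (represents (λ i≡j → i≢j (≡.cong suc i≡j)))
      (≉0-resp (sym (trans (standardProduct-++ (φ i) (φ j) (standardBasis i) (standardBasis j))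
        (trans (+-congˡ (trans (standardBasis-product i (standardBasis j))
          (conj-zero (standardBasis-off (λ j≡i → i≢j (≡.cong suc (≡.sym j≡i)))))))
        (+-identityʳ _)))))

  -- The `n` vectors of any representation span at most `n` dimensions.
  rep-order : ∀ {n} (G : Graph n) → Rep n G
  rep-order G with rep-exists G
  ... | d , φ , represents = pad G size≤ ((λ i → coordinates (space d) e (φ i)) ,
          represents-coordinates (space d) G e (λ {i} _ → inj₁ (expands i)) represents)
    where open Space.OrthonormalSpan d (Space.gram-schmidt d φ)

  -- The coordinates with respect to the span of the other vectors already
  -- determine all inner products except the norm of φ v.
  rep-span : ∀ {n d} (G : Graph (suc n)) {φ : Fin (suc n) → Fin d → Carrier} v →
    Represents (space d) G φ →
    Σ[ 𝓔 ∈ Space.OrthonormalSpan d (φ ∘ punchIn v) ] Rep (Space.OrthonormalSpan.size 𝓔) G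
  rep-span {n} {d} G {φ} v represents = 𝓔 , (λ i → coordinates (space d) e (φ i)) ,
    represents-coordinates (space d) G e expands-one represents
    where
    open Space d
    𝓔 : OrthonormalSpan (φ ∘ punchIn v)
    𝓔 = gram-schmidt (φ ∘ punchIn v)
    open OrthonormalSpan 𝓔

    expands-other : ∀ {i} → v ≢ i → Expands e (φ i)
    expands-other v≢i = ≡.subst (λ i → Expands e (φ i)) (Fin.punchIn-punchOut v≢i) (expands _)

    expands-one : ∀ {i j} → i ≢ j → Expands e (φ i) ⊎ Expands e (φ j)
    expands-one {i} {j} i≢j with v Fin.≟ i
    ... | yes ≡.refl = inj₂ (expands-other i≢j)
    ... | no  v≢i    = inj₁ (expands-other v≢i)

-- Generic reflections

module Reflections {R : RealNumbers} (K : Scalars R) (isStarField : IsStarField K) where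
  open Constructions K isStarField public
  open RingProperties ring using (+-cancelˡ)

  fromℕ : ℕ → Carrier
  fromℕ n = sum {n} (λ _ → 1#)

  fromℕ-conj : ∀ n → conj (fromℕ n) ≈ fromℕ n
  fromℕ-conj n = trans (conj-sum {n} _) (sum-cong-≋ {n} (λ _ → conj-1))

  -- fromℕ n is the squared norm of (1 , … , 1).
  fromℕ-suc≉0 : ∀ n → ¬ fromℕ (suc n) ≈ 0#
  fromℕ-suc≉0 n e = 0≉1 (sym (InnerProductSpace.⟨⟩-def (space (suc n)) (λ _ → 1#)
    (trans (sum-cong-≋ {suc n} (λ _ → trans (*-identityˡ _) conj-1)) e) zero))

  fromℕ-injective : ∀ {m n} → fromℕ m ≈ fromℕ n → m ≡ n
  fromℕ-injective {zero}  {zero}  _ = ≡.refl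
  fromℕ-injective {zero}  {suc n} e = contradiction (sym e) (fromℕ-suc≉0 n)
  fromℕ-injective {suc m} {zero}  e = contradiction e (fromℕ-suc≉0 m)
  fromℕ-injective {suc m} {suc n} e = ≡.cong suc (fromℕ-injective (+-cancelˡ 1# _ _ e))

  quadratic : Carrier → Carrier → Carrier → Carrier → Carrier
  quadratic a b c t = a + t * b + t * t * c

  difference-quotient : ∀ {a b c x y} → ¬ x - y ≈ 0# → quadratic a b c x ≈ 0# → quadratic a b c y ≈ 0# →
                        b + (x + y) * c ≈ 0#
  difference-quotient {a} {b} {c} {x} {y} x-y≉0 px py = x*y≈0⇒y≈0 x-y≉0 (trans
    (solve 5 (λ a b c x y → (x :- y) :* (b :+ (x :+ y) :* c) :=
      (a :+ x :* b :+ x :* x :* c) :- (a :+ y :* b :+ y :* y :* c)) refl a b c x y)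
    (trans (+-cong px (trans (-‿cong py) -0#≈0#)) (+-identityˡ 0#)))

  -- `c` is the second divided difference, so it vanishes, and then so does `a`. Only these two are
  -- recorded because they will be the values of `reflected` at `x` and `y`.
  three-roots : ∀ {a b c x y z} → ¬ x - y ≈ 0# → ¬ x - z ≈ 0# → ¬ y - z ≈ 0# →
    quadratic a b c x ≈ 0# → quadratic a b c y ≈ 0# → quadratic a b c z ≈ 0# → a ≈ 0# × c ≈ 0#
  three-roots {a} {b} {c} {x} {y} {z} x≉y x≉z y≉z px py pz = a≈0 , c≈0
    where
    b+[x+y]c≈0 : b + (x + y) * c ≈ 0#
    b+[x+y]c≈0 = difference-quotient {a} x≉y px py
    c≈0 : c ≈ 0#
    c≈0 = x*y≈0⇒y≈0 y≉z (trans
      (solve 5 (λ b c x y z → (y :- z) :* c := (b :+ (x :+ y) :* c) :- (b :+ (x :+ z) :* c)) refl b c x y z)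
      (trans (+-cong b+[x+y]c≈0 (trans (-‿cong (difference-quotient {a} x≉z px pz)) -0#≈0#)) (+-identityˡ 0#)))
    a≈0 : a ≈ 0#
    a≈0 = trans
      (solve 4 (λ a b c x → a := (a :+ x :* b :+ x :* x :* c) :- x :* (b :+ x :* c)) refl a b c x)
      (trans (+-cong px (trans (-‿cong (trans (*-congˡ b+xc≈0) (zeroʳ x))) -0#≈0#)) (+-identityˡ 0#))
      where
      b+xc≈0 : b + x * c ≈ 0#
      b+xc≈0 = trans (+-congˡ (trans (trans (*-congˡ c≈0) (zeroʳ x))
        (sym (trans (*-congˡ c≈0) (zeroʳ (x + y)))))) b+[x+y]c≈0

  -- Split the candidates into three blocks: each contains a non-root of the last N - 1
  -- quadratics, and one of these three is not a root of the first.
  common-nonroot : ∀ N (a b c : Fin N → Carrier) → (∀ k → ¬ (a k ≈ 0# × c k ≈ 0#)) →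
    (f : Fin (3 ^ N) → ℕ) → Injective _≡_ _≡_ f →
    ∃[ i ] (∀ k → ¬ quadratic (a k) (b k) (c k) (fromℕ (f i)) ≈ 0#)
  common-nonroot zero    a b c nonzero f f-injective = zero , λ ()
  common-nonroot (suc N) a b c nonzero f f-injective =
    pick (Fin.any? (λ j → ¬? (value j ≟ 0#)))
    where
    block : (j : Fin 3) → ∃[ i ] (∀ k → ¬ quadratic (a (suc k)) (b (suc k)) (c (suc k)) (fromℕ (f (combine j i))) ≈ 0#)
    block j = common-nonroot N (a ∘ suc) (b ∘ suc) (c ∘ suc) (nonzero ∘ suc) (f ∘ combine j)
      (λ {x} {y} e → Fin.combine-injectiveʳ j x j y (f-injective e))
    candidate : Fin 3 → Fin (3 ^ suc N)
    candidate j = combine j (proj₁ (block j))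
    value : Fin 3 → Carrier
    value j = quadratic (a zero) (b zero) (c zero) (fromℕ (f (candidate j)))
    distinct : ∀ {i j} → i ≢ j → ¬ fromℕ (f (candidate i)) - fromℕ (f (candidate j)) ≈ 0#
    distinct {i} {j} i≢j e = i≢j (Fin.combine-injectiveˡ i _ j _
      (f-injective (fromℕ-injective (sym (y-x≈0⇒x≈y e)))))
    pick : Dec (∃[ j ] ¬ value j ≈ 0#) →
           ∃[ i ] (∀ k → ¬ quadratic (a k) (b k) (c k) (fromℕ (f i)) ≈ 0#)
    pick (yes (j , ≉0)) = candidate j , λ { zero → ≉0 ; (suc k) → proj₂ (block j) k }
    pick (no ∄) = contradiction
      (three-roots {a zero} {b zero} {c zero} (distinct {zero} {suc zero} (λ ())) (distinct {zero} {suc (suc zero)} (λ ()))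
        (distinct {suc zero} {suc (suc zero)} (λ ()))
        (root zero) (root (suc zero)) (root (suc (suc zero)))) (nonzero zero)
      where
      root : ∀ j → value j ≈ 0#
      root j = decidable-stable (value j ≟ 0#) (λ ≉0 → ∄ (j , ≉0))

  module _ (d : ℕ) where
    open Space d

    -- The inner product of f with the reflection of g in z⊥, scaled by ⟨ z , z ⟩ to avoid division.
    reflected : Carrierᴹ → Carrierᴹ → Carrierᴹ → Carrier
    reflected f g z = ⟨ z , z ⟩ * ⟨ f , g ⟩ - (⟨ f , z ⟩ * ⟨ z , g ⟩ + ⟨ f , z ⟩ * ⟨ z , g ⟩)

    -- Self-conjugacy of `t` turns the conjugate-linear slots into polynomials in `t`. The outer
    -- coefficients are the values at `x` and at `y`, so one good endpoint makes the quadratic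
    -- nonzero.
    reflected-line : ∀ f g x y t → conj t ≈ t → reflected f g (x +ᴹ t *ₗ y) ≈
      quadratic (reflected f g x)
        ((⟨ x , y ⟩ + ⟨ y , x ⟩) * ⟨ f , g ⟩ -
          ((⟨ f , x ⟩ * ⟨ y , g ⟩ + ⟨ f , y ⟩ * ⟨ x , g ⟩) +
           (⟨ f , x ⟩ * ⟨ y , g ⟩ + ⟨ f , y ⟩ * ⟨ x , g ⟩)))
        (reflected f g y) t
    reflected-line f g x y t t̄≈t = trans
      (+-cong (*-congʳ zz) (-‿cong (+-cong (*-cong fz zg) (*-cong fz zg))))
      (solve 10 (λ t fg xx xy yx yy fx fy xg yg →
        ((xx :+ t :* xy) :+ t :* (yx :+ t :* yy)) :* fg :-
          ((fx :+ t :* fy) :* (xg :+ t :* yg) :+ (fx :+ t :* fy) :* (xg :+ t :* yg)) :=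
        (xx :* fg :- (fx :* xg :+ fx :* xg)) :+
        t :* ((xy :+ yx) :* fg :- ((fx :* yg :+ fy :* xg) :+ (fx :* yg :+ fy :* xg))) :+
        t :* t :* (yy :* fg :- (fy :* yg :+ fy :* yg)))
        refl t (⟨ f , g ⟩) (⟨ x , x ⟩) (⟨ x , y ⟩) (⟨ y , x ⟩) (⟨ y , y ⟩)
               (⟨ f , x ⟩) (⟨ f , y ⟩) (⟨ x , g ⟩) (⟨ y , g ⟩))
      where
      z : Carrierᴹ
      z = x +ᴹ t *ₗ y
      right : ∀ h → ⟨ h , z ⟩ ≈ ⟨ h , x ⟩ + t * ⟨ h , y ⟩
      right h = trans (⟨⟩-+ʳ h x (t *ₗ y)) (+-congˡ (trans (⟨⟩-*ʳ t h y) (*-congʳ t̄≈t)))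
      left : ∀ h → ⟨ z , h ⟩ ≈ ⟨ x , h ⟩ + t * ⟨ y , h ⟩
      left h = trans (⟨⟩-+ˡ x (t *ₗ y) h) (+-congˡ (⟨⟩-*ˡ t y h))
      fz = right f
      zg = left g
      zz : ⟨ z , z ⟩ ≈ (⟨ x , x ⟩ + t * ⟨ x , y ⟩) + t * (⟨ y , x ⟩ + t * ⟨ y , y ⟩)
      zz = trans (left z) (+-cong (right x) (*-congˡ (right y)))

    2*x≉0 : ∀ {x} → ¬ x ≈ 0# → ¬ x + x ≈ 0#
    2*x≉0 {x} x≉0 e = ≉0-* (fromℕ-suc≉0 1) x≉0
      -- The left factor is `fromℕ 2` unfolded.
      (trans (solve 1 (λ x → (con (1 , 0) :+ (con (1 , 0) :+ con (0 , 0))) :* x := x :+ x) refl x) e)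

    -- If f and g are orthogonal take z = f + g, otherwise z = f.
    reflected-nonzero : ∀ f g → ¬ ⟨ f , f ⟩ ≈ 0# → ¬ ⟨ g , g ⟩ ≈ 0# →
                        ∃[ z ] ¬ reflected f g z ≈ 0#
    reflected-nonzero f g ff≉0 gg≉0 with ⟨ f , g ⟩ ≟ 0#
    ... | no fg≉0 = f , λ e → ≉0-* ff≉0 fg≉0 (trans
      (solve 2 (λ a b → a :* b := :- (a :* b :- (a :* b :+ a :* b))) refl (⟨ f , f ⟩) (⟨ f , g ⟩))
      (trans (-‿cong e) -0#≈0#))
    ... | yes fg≈0 = f +ᴹ g , λ e → 2*x≉0 (≉0-* ff≉0 gg≉0) (trans
      (sym (+-cong (*-cong fz zg) (*-cong fz zg)))
      (trans (solve 2 (λ a b → b := a :- (a :- b)) refl (⟨ f +ᴹ g , f +ᴹ g ⟩ * ⟨ f , g ⟩) _)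
        (trans (+-cong (trans (*-congˡ fg≈0) (zeroʳ _)) (trans (-‿cong e) -0#≈0#)) (+-identityˡ 0#))))
      where
      fz : ⟨ f , f +ᴹ g ⟩ ≈ ⟨ f , f ⟩
      fz = trans (⟨⟩-+ʳ f f g) (trans (+-congˡ fg≈0) (+-identityʳ _))
      zg : ⟨ f +ᴹ g , g ⟩ ≈ ⟨ g , g ⟩
      zg = trans (⟨⟩-+ˡ f g g) (trans (+-congʳ fg≈0) (+-identityˡ _))

    generic-direction : ∀ N (f g : Fin N → Carrierᴹ) →
      (∀ k → ¬ ⟨ f k , f k ⟩ ≈ 0#) → (∀ k → ¬ ⟨ g k , g k ⟩ ≈ 0#) →
      Σ[ z ∈ Carrierᴹ ] (∀ k → ¬ reflected (f k) (g k) z ≈ 0#)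
    generic-direction zero    f g ff≉0 gg≉0 = 0ᴹ , λ ()
    generic-direction (suc N) f g ff≉0 gg≉0 =
      let x , x-good = generic-direction N (f ∘ suc) (g ∘ suc) (ff≉0 ∘ suc) (gg≉0 ∘ suc)
          y , y-good = reflected-nonzero (f zero) (g zero) (ff≉0 zero) (gg≉0 zero)
          i , nonroot = common-nonroot (suc N)
            (λ k → reflected (f k) (g k) x) _ (λ k → reflected (f k) (g k) y)
            -- The first pair has nonzero leading coefficient thanks to `y`, the others nonzero
            -- constant term thanks to `x`.
            (λ { zero (_ , c≈0) → y-good c≈0 ; (suc k) (a≈0 , _) → x-good k a≈0 })
            toℕ Fin.toℕ-injective
          t = fromℕ (toℕ i)
      in  x +ᴹ t *ₗ y , λ k e → nonroot k (trans
            (sym (reflected-line (f k) (g k) x y t (fromℕ-conj (toℕ i)))) e)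

    conj-neg : ∀ x → conj (- x) ≈ - conj x
    conj-neg x = trans (solve 2 (λ a b → a := (a :+ b) :- b) refl (conj (- x)) (conj x))
      (trans (+-congʳ (trans (sym (conj-+ (- x) x)) (conj-zero (-‿inverseˡ x)))) (+-identityˡ _))

    reflection : Carrierᴹ → Carrierᴹ → Carrierᴹ
    reflection z g = (⟨ z , z ⟩ *ₗ g) +ᴹ ((- (⟨ g , z ⟩ + ⟨ g , z ⟩)) *ₗ z)

    reflection-product : ∀ f g z → ⟨ f , reflection z g ⟩ ≈ reflected f g z
    reflection-product f g z = begin
      ⟨ f , reflection z g ⟩
        ≈⟨ ⟨⟩-+ʳ f (⟨ z , z ⟩ *ₗ g) _ ⟩
      ⟨ f , ⟨ z , z ⟩ *ₗ g ⟩ + ⟨ f , (- (⟨ g , z ⟩ + ⟨ g , z ⟩)) *ₗ z ⟩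
        ≈⟨ +-cong (⟨⟩-*ʳ (⟨ z , z ⟩) f g) (⟨⟩-*ʳ _ f z) ⟩
      conj (⟨ z , z ⟩) * ⟨ f , g ⟩ + conj (- (⟨ g , z ⟩ + ⟨ g , z ⟩)) * ⟨ f , z ⟩
        ≈⟨ +-cong (*-congʳ (sym (⟨⟩-conj z z))) (*-congʳ (trans (conj-neg _) (-‿cong
             (trans (conj-+ _ _) (+-cong (sym (⟨⟩-conj g z)) (sym (⟨⟩-conj g z))))))) ⟩
      ⟨ z , z ⟩ * ⟨ f , g ⟩ + - (⟨ z , g ⟩ + ⟨ z , g ⟩) * ⟨ f , z ⟩
        ≈⟨ solve 3 (λ a fz zg → a :+ :- (zg :+ zg) :* fz := a :- (fz :* zg :+ fz :* zg)) refl
             (⟨ z , z ⟩ * ⟨ f , g ⟩) (⟨ f , z ⟩) (⟨ z , g ⟩) ⟩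
      reflected f g z ∎
      where open SetoidReasoning setoid

    -- The scaling by the self-conjugate `⟨ z , z ⟩` contributes a factor in each slot. For nonzero
    -- `z` the orthogonality pattern of `H` therefore survives.
    reflection-isometry : ∀ z g h →
      ⟨ reflection z g , reflection z h ⟩ ≈ ⟨ z , z ⟩ * ⟨ z , z ⟩ * ⟨ g , h ⟩
    reflection-isometry z g h = begin
      ⟨ reflection z g , reflection z h ⟩
        ≈⟨ ⟨⟩-+ˡ (⟨ z , z ⟩ *ₗ g) _ (reflection z h) ⟩
      ⟨ ⟨ z , z ⟩ *ₗ g , reflection z h ⟩ + ⟨ (- (⟨ g , z ⟩ + ⟨ g , z ⟩)) *ₗ z , reflection z h ⟩
        ≈⟨ +-cong (⟨⟩-*ˡ (⟨ z , z ⟩) g (reflection z h)) (⟨⟩-*ˡ _ z (reflection z h)) ⟩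
      ⟨ z , z ⟩ * ⟨ g , reflection z h ⟩ + - (⟨ g , z ⟩ + ⟨ g , z ⟩) * ⟨ z , reflection z h ⟩
        ≈⟨ +-cong (*-congˡ (reflection-product g h z)) (*-congˡ (reflection-product z h z)) ⟩
      ⟨ z , z ⟩ * reflected g h z + - (⟨ g , z ⟩ + ⟨ g , z ⟩) * reflected z h z
        ≈⟨ solve 4 (λ zz gh gz zh →
             zz :* (zz :* gh :- (gz :* zh :+ gz :* zh)) :+
             :- (gz :+ gz) :* (zz :* zh :- (zz :* zh :+ zz :* zh)) := zz :* zz :* gh) refl
             (⟨ z , z ⟩) (⟨ g , h ⟩) (⟨ g , z ⟩) (⟨ z , h ⟩) ⟩
      ⟨ z , z ⟩ * ⟨ z , z ⟩ * ⟨ g , h ⟩ ∎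
      where open SetoidReasoning setoid

-- Joins and glued graphs

open import Data.Nat.Base using (_+_; _∸_; _≥_)

neighbour : ∀ {n} (G : Graph n) → Connected G → 1 < n → ∀ i → ∃[ j ] Graph.Adj G i j
neighbour G connected (s≤s (s≤s _)) i with connected i (punchIn i zero) | Fin.punchInᵢ≢i i zero
... | path | ≢i = first path ≢i
  where
  first : ∀ {j} → Star (Graph.Adj G) i j → j ≢ i → ∃[ j ] Graph.Adj G i j
  first ε       i≢i = contradiction ≡.refl i≢i
  first (a ◅ _) _   = _ , a

splitAt-injective : ∀ {m n} → Injective _≡_ _≡_ (splitAt m {n})
splitAt-injective = Injection.injective (↔⇒↣ Fin.+↔⊎)

-- Repeats the labelling local to `glue`, so that adjacency there unfolds to `GlueAdj` of these
-- labels.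
vertex : ∀ {n k} → Fin (suc k) → Fin (n + k) → Fin n ⊎ Fin (suc k)
vertex {n} w i = Sum.map id (punchIn w) (splitAt n i)

vertex-injective : ∀ {n k} (w : Fin (suc k)) → Injective _≡_ _≡_ (vertex {n} w)
vertex-injective {n} {k} w {i} {j} e = splitAt-injective {n} (go (splitAt n i) (splitAt n j) e)
  where
  go : ∀ (p q : Fin n ⊎ Fin k) → Sum.map id (punchIn w) p ≡ Sum.map id (punchIn w) q → p ≡ q
  go (inj₁ _) (inj₁ _) e = ≡.cong inj₁ (inj₁-injective e)
  go (inj₂ x) (inj₂ y) e = ≡.cong inj₂ (Fin.punchIn-injective w x y (inj₂-injective e))

vertex≢inj₂ : ∀ {n k} (w : Fin (suc k)) (i : Fin (n + k)) → vertex w i ≢ inj₂ w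
vertex≢inj₂ {n} w i e with splitAt n i
... | inj₂ x = Fin.punchInᵢ≢i w x (inj₂-injective e)

module Embedding {n k : ℕ} (v : Fin n) (w : Fin (suc k)) where

  -- The copy of `H` inside the glued graph: `w` is relabelled as `v`, and `inj₂ w` is never hit.
  image : Fin (suc k) → Fin n ⊎ Fin (suc k)
  image i with w Fin.≟ i
  ... | yes _ = inj₁ v
  ... | no  _ = inj₂ i

  embed : Fin (suc k) → Fin (n + k)
  embed i with w Fin.≟ i
  ... | yes _   = v ↑ˡ k
  ... | no  w≢i = n ↑ʳ punchOut w≢i

  vertex-↑ˡ : ∀ i → vertex w (i ↑ˡ k) ≡ inj₁ i
  vertex-↑ˡ i = ≡.cong (Sum.map id (punchIn w)) (Fin.splitAt-↑ˡ n i k)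

  vertex-embed : ∀ i → vertex w (embed i) ≡ image i
  vertex-embed i with w Fin.≟ i
  ... | yes _   = vertex-↑ˡ v
  ... | no  w≢i = ≡.trans (≡.cong (Sum.map id (punchIn w)) (Fin.splitAt-↑ʳ n k (punchOut w≢i)))
                          (≡.cong inj₂ (Fin.punchIn-punchOut w≢i))

  image-other : ∀ {i} → w ≢ i → image i ≡ inj₂ i
  image-other {i} w≢i with w Fin.≟ i
  ... | yes w≡i = contradiction w≡i w≢i
  ... | no  _   = ≡.refl

  image-injective : Injective _≡_ _≡_ image
  image-injective {i} {j} e with w Fin.≟ i | w Fin.≟ j
  ... | yes ≡.refl | yes ≡.refl = ≡.refl
  ... | no  _      | no  _      = inj₂-injective e

  embed-injective : Injective _≡_ _≡_ embed
  embed-injective {i} {j} e = image-injective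
    (≡.trans (≡.sym (vertex-embed i)) (≡.trans (≡.cong (vertex w) e) (vertex-embed j)))

  image-adj : ∀ (G : Graph n) (H : Graph (suc k)) {i j} → i ≢ j →
              Graph.Adj H i j ⇔ GlueAdj G H v w (image i) (image j)
  image-adj G H {i} {j} i≢j with w Fin.≟ i | w Fin.≟ j
  ... | yes ≡.refl | yes ≡.refl = contradiction ≡.refl i≢j
  ... | yes ≡.refl | no  _      = mk⇔ (≡.refl ,_) proj₂
  ... | no  _      | yes ≡.refl = mk⇔ (≡.refl ,_) proj₂
  ... | no  _      | no  _      = mk⇔ id id

  ↑ˡ-adj : ∀ (G : Graph n) (H : Graph (suc k)) i j →
           Graph.Adj G i j ⇔ Graph.Adj (glue G H v w) (i ↑ˡ k) (j ↑ˡ k)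
  ↑ˡ-adj G H i j = ≡.subst₂ (λ p q → Graph.Adj G i j ⇔ GlueAdj G H v w p q)
    (≡.sym (vertex-↑ˡ i)) (≡.sym (vertex-↑ˡ j)) (mk⇔ id id)

  embed-adj : ∀ (G : Graph n) (H : Graph (suc k)) {i j} → i ≢ j →
              Graph.Adj H i j ⇔ Graph.Adj (glue G H v w) (embed i) (embed j)
  embed-adj G H {i} {j} i≢j = ≡.subst₂ (λ p q → Graph.Adj H i j ⇔ GlueAdj G H v w p q)
    (≡.sym (vertex-embed i)) (≡.sym (vertex-embed j)) (image-adj G H i≢j)

module Composites {R : RealNumbers} (K : Scalars R) (isStarField : IsStarField K) where
  open Reflections K isStarField hiding (_+_)

  module _ {d : ℕ} where
    open Space d

    merge : ∀ {n m} → (Fin n → Carrierᴹ) → (Fin m → Carrierᴹ) → Fin n ⊎ Fin m → Carrierᴹ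
    merge f g = Sum.[ f , g ]

    orthonormal-++ : ∀ {p q} {e : Fin p → Carrierᴹ} {e′ : Fin q → Carrierᴹ} →
      Orthonormal e → Orthonormal e′ → (∀ k l → ⟨ e k , e′ l ⟩ ≈ 0#) → Orthonormal (e ++ e′)
    orthonormal-++ {p} {q} {e} {e′} o o′ e⊥e′ = record
      { unit       = λ k → unit⊎ (splitAt p k)
      ; orthogonal = λ {k} {l} k≢l → orthogonal⊎ (splitAt p k) (splitAt p l)
                                       (λ eq → k≢l (splitAt-injective {p} eq)) }
      where
      unit⊎ : ∀ x → ⟨ merge e e′ x , merge e e′ x ⟩ ≈ 1#
      unit⊎ (inj₁ k) = unit o k
      unit⊎ (inj₂ l) = unit o′ l
      orthogonal⊎ : ∀ x y → x ≢ y → ⟨ merge e e′ x , merge e e′ y ⟩ ≈ 0#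
      orthogonal⊎ (inj₁ k) (inj₁ l) k≢l = orthogonal o (λ k≡l → k≢l (≡.cong inj₁ k≡l))
      orthogonal⊎ (inj₁ k) (inj₂ l) _   = e⊥e′ k l
      orthogonal⊎ (inj₂ k) (inj₁ l) _   = orthogonal-sym {e l} {e′ k} (e⊥e′ l k)
      orthogonal⊎ (inj₂ k) (inj₂ l) k≢l = orthogonal o′ (λ k≡l → k≢l (≡.cong inj₂ k≡l))

    generic-reflection : ∀ {n m} (f : Fin n → Carrierᴹ) (g : Fin m → Carrierᴹ) → Fin n → Fin m →
      (∀ i → ¬ ⟨ f i , f i ⟩ ≈ 0#) → (∀ j → ¬ ⟨ g j , g j ⟩ ≈ 0#) →
      Σ[ z ∈ Carrierᴹ ] (¬ ⟨ z , z ⟩ ≈ 0#) × (∀ i j → ¬ ⟨ f i , reflection d z (g j) ⟩ ≈ 0#)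
    generic-reflection {n} {m} f g i₀ j₀ ff≉0 gg≉0
      with generic-direction d (n ℕ.* m) (λ k → f (proj₁ (remQuot {n} m k))) (λ k → g (proj₂ (remQuot {n} m k)))
             (λ k → ff≉0 (proj₁ (remQuot {n} m k))) (λ k → gg≉0 (proj₂ (remQuot {n} m k)))
    -- The chosen pair `i₀`, `j₀` guarantees that there is at least one product; it would vanish if
    -- `z` did.
    ... | z , good = z , (λ zz≈0 → generic i₀ j₀ (degenerate zz≈0)) , generic
      where
      generic : ∀ i j → ¬ ⟨ f i , reflection d z (g j) ⟩ ≈ 0#
      generic i j e = good (combine i j) (≡.subst
        (λ (i , j) → reflected d (f i) (g j) z ≈ 0#) (≡.sym (Fin.remQuot-combine i j))
        (trans (sym (reflection-product d (f i) (g j) z)) e))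

      degenerate : ⟨ z , z ⟩ ≈ 0# → ⟨ f i₀ , reflection d z (g j₀) ⟩ ≈ 0#
      degenerate zz≈0 = trans (reflection-product d (f i₀) (g j₀) z) (trans
        (+-cong (trans (*-congʳ zz≈0) (zeroˡ _)) (-‿cong (trans (+-cong fz*zg fz*zg) (+-identityˡ 0#))))
        (trans (+-identityˡ _) -0#≈0#))
        where
        fz*zg : ⟨ f i₀ , z ⟩ * ⟨ z , g j₀ ⟩ ≈ 0#
        fz*zg = trans (*-congˡ (trans (⟨⟩-cong (⟨⟩-def z zz≈0) (≈ᴹ-refl {g j₀})) (⟨⟩-zeroˡ (g j₀)))) (zeroʳ _)

  rep-join-generic : ∀ {d n m} (G : Graph n) (H : Graph m) ((φ , _) : Rep d G) ((χ , _) : Rep d H) z →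
    ¬ standardProduct z z ≈ 0# → (∀ i j → ¬ standardProduct (φ i) (reflection d z (χ j)) ≈ 0#) →
    Rep d (G ∨ H)
  rep-join-generic {d} {n} {m} G H (φ , repG) (χ , repH) z zz≉0 generic =
    (λ i → Φ (splitAt n i)) , λ {i} {j} i≢j →
      realises (splitAt n i) (splitAt n j) (λ e → i≢j (splitAt-injective {n} e))
    where
    open Space d
    Φ : Fin n ⊎ Fin m → Carrierᴹ
    Φ = merge φ (λ j → reflection d z (χ j))

    realises : ∀ p q → p ≢ q → Realises (space d) (JoinAdj G H) Φ p q
    realises (inj₁ i) (inj₁ j) i≢j = repG (λ i≡j → i≢j (≡.cong inj₁ i≡j))
    realises (inj₁ i) (inj₂ j) _   = mk⇔ (λ _ → generic i j) (λ _ → tt)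
    realises (inj₂ i) (inj₁ j) _   = mk⇔
      (λ _ e → generic j i (orthogonal-sym {reflection d z (χ i)} {φ j} e)) (λ _ → tt)
    realises (inj₂ i) (inj₂ j) i≢j = ⇔-trans (repH (λ i≡j → i≢j (≡.cong inj₂ i≡j))) (mk⇔
      (λ ≉0 e → ≉0-* (≉0-* zz≉0 zz≉0) ≉0 (trans (sym (reflection-isometry d z (χ i) (χ j))) e))
      (λ ≉0 e → ≉0 (trans (reflection-isometry d z (χ i) (χ j)) (trans (*-congˡ e) (zeroʳ _)))))

  rep-join : ∀ {d n m} (G : Graph n) (H : Graph m) → Connected G → Connected H → 1 < n → 1 < m →
             Rep d G → Rep d H → Rep d (G ∨ H)
  rep-join {d} {suc _} {suc _} G H connG connH 1<n 1<m repG repH =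
    let z , zz≉0 , generic = generic-reflection (proj₁ repG) (proj₁ repH) zero zero
          (λ i → norm≉0 (space d) G (proj₂ repG) (proj₂ (neighbour G connG 1<n i)))
          (λ j → norm≉0 (space d) H (proj₂ repH) (proj₂ (neighbour H connH 1<m j)))
    in  rep-join-generic G H repG repH z zz≉0 generic

  rep-join⇒rep : ∀ {d n m} (G : Graph n) (H : Graph m) → Rep d (G ∨ H) → Rep d G
  rep-join⇒rep {d} {n} {m} G H (φ , represents) = (λ i → φ (i ↑ˡ m)) ,
    represents-induced (space d) (G ∨ H) G (_↑ˡ m) (Fin.↑ˡ-injective m _ _)
      (λ {i} {j} _ → ≡.subst₂ (λ p q → Graph.Adj G i j ⇔ JoinAdj G H p q)
        (≡.sym (Fin.splitAt-↑ˡ n i m)) (≡.sym (Fin.splitAt-↑ˡ n j m)) (mk⇔ id id)) represents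

  -- The common vertex receives `φ v` in the first summand and `χ w` in the second, and every other
  -- vertex has a zero part in the summand of the other graph.
  rep-glue : ∀ {p q n k} (G : Graph n) (H : Graph (suc k)) v w →
             Rep p G → Rep q H → Rep (p + q) (glue G H v w)
  rep-glue {p} {q} {n} {k} G H v w (φ , repG) (χ , repH) =
    (λ i → Φ (vertex w i)) , λ {i} {j} i≢j →
      realises (vertex w i) (vertex w j) (λ e → i≢j (vertex-injective w e))
        (vertex≢inj₂ w i) (vertex≢inj₂ w j)
    where
    α : Fin n ⊎ Fin (suc k) → Fin p → Carrier
    α (inj₁ i) = φ i
    α (inj₂ x) = λ _ → 0#

    at-v : ∀ {i} → Dec (i ≡ v) → Fin q → Carrier
    at-v (yes _) = χ w
    at-v (no _)  = λ _ → 0#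

    β : Fin n ⊎ Fin (suc k) → Fin q → Carrier
    β (inj₁ i) = at-v (i Fin.≟ v)
    β (inj₂ x) = χ x

    Φ : Fin n ⊎ Fin (suc k) → Fin (p + q) → Carrier
    Φ x = α x ++ β x

    at-v-product : ∀ {i j} (a : Dec (i ≡ v)) (b : Dec (j ≡ v)) → i ≢ j →
                   standardProduct (at-v a) (at-v b) ≈ 0#
    at-v-product (yes ≡.refl) (yes ≡.refl) i≢j = contradiction ≡.refl i≢j
    at-v-product (yes _) (no _) _ = Space.orthogonal-sym q {λ _ → 0#} {χ w} (Space.⟨⟩-zeroˡ q (χ w))
    at-v-product (no _)  b      _ = Space.⟨⟩-zeroˡ q (at-v b)

    cross : ∀ {i} (a : Dec (i ≡ v)) {y} → y ≢ w →
            (i ≡ v × Graph.Adj H w y) ⇔ (¬ standardProduct (at-v a) (χ y) ≈ 0#)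
    cross (yes i≡v) y≢w = ⇔-trans (mk⇔ proj₂ (i≡v ,_)) (repH (λ w≡y → y≢w (≡.sym w≡y)))
    cross (no i≢v) {y} _ = mk⇔ (λ (i≡v , _) → contradiction i≡v i≢v)
                               (λ ≉0 → contradiction (Space.⟨⟩-zeroˡ q (χ y)) ≉0)

    glued : ∀ i {y} → y ≢ w → Realises (space (p + q)) (GlueAdj G H v w) Φ (inj₁ i) (inj₂ y)
    glued i {y} y≢w = ⇔-trans (cross (i Fin.≟ v) y≢w) (≉0-resp (sym (trans
      (standardProduct-++ (φ i) (λ _ → 0#) (β (inj₁ i)) (χ y))
      (trans (+-congʳ (Space.orthogonal-sym p {λ _ → 0#} {φ i} (Space.⟨⟩-zeroˡ p (φ i)))) (+-identityˡ _)))))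

    realises : ∀ x y → x ≢ y → x ≢ inj₂ w → y ≢ inj₂ w →
               Realises (space (p + q)) (GlueAdj G H v w) Φ x y
    realises (inj₁ i) (inj₁ j) i≢j _ _ = ⇔-trans (repG (λ i≡j → i≢j (≡.cong inj₁ i≡j)))
      (≉0-resp (sym (trans (standardProduct-++ (φ i) (φ j) (β (inj₁ i)) (β (inj₁ j)))
        (trans (+-congˡ (at-v-product (i Fin.≟ v) (j Fin.≟ v) (λ i≡j → i≢j (≡.cong inj₁ i≡j))))
               (+-identityʳ _)))))
    realises (inj₁ i) (inj₂ y) _ _ y≢w = glued i (λ y≡w → y≢w (≡.cong inj₂ y≡w))
    realises (inj₂ x) (inj₁ j) _ x≢w _ = realises-sym (space (p + q)) {φ = Φ}
      (λ {a} {b} → glueAdj-symm G H v w {a} {b}) (inj₁ j) (inj₂ x) (glued j (λ x≡w → x≢w (≡.cong inj₂ x≡w)))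
    realises (inj₂ x) (inj₂ y) x≢y _ _ = ⇔-trans (repH (λ x≡y → x≢y (≡.cong inj₂ x≡y)))
      (≉0-resp (sym (trans (standardProduct-++ {p} (λ _ → 0#) (λ _ → 0#) (χ x) (χ y))
        (trans (+-congʳ (Space.⟨⟩-zeroˡ p (λ _ → 0#))) (+-identityˡ _)))))

  -- The vectors of G - v are orthogonal to those of H - w, hence so are their spans,
  -- and by rep-span each span carries a representation of G, respectively H.
  rep-glue⇒reps : ∀ {d n k} (G : Graph (suc n)) (H : Graph (suc k)) v w →
    Rep d (glue G H v w) → ∃[ p ] ∃[ q ] p + q ≤ d × Rep p G × Rep q H
  rep-glue⇒reps {d} {n} {k} G H v w (φ , represents) =
    size 𝓔 , size 𝓕 , orthonormal-size (orthonormal-++ (orthonormal 𝓔) (orthonormal 𝓕) e⊥e′) ,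
    proj₂ spanG , proj₂ spanH
    where
    open Space d
    open OrthonormalSpan
    open Embedding {k = k} v w
    f : Fin (suc n) → Carrierᴹ
    f i = φ (i ↑ˡ k)
    h : Fin (suc k) → Carrierᴹ
    h j = φ (embed j)

    spanG : Σ[ 𝓔 ∈ OrthonormalSpan (f ∘ punchIn v) ] Rep (size 𝓔) G
    spanG = rep-span G v (represents-induced (space d) (glue G H v w) G (_↑ˡ k)
      (Fin.↑ˡ-injective k _ _) (λ {i} {j} _ → ↑ˡ-adj G H i j) represents)
    spanH : Σ[ 𝓕 ∈ OrthonormalSpan (h ∘ punchIn w) ] Rep (size 𝓕) H
    spanH = rep-span H w (represents-induced (space d) (glue G H v w) H embed
      embed-injective (embed-adj G H) represents)
    𝓔 : OrthonormalSpan (f ∘ punchIn v)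
    𝓔 = proj₁ spanG
    𝓕 : OrthonormalSpan (h ∘ punchIn w)
    𝓕 = proj₁ spanH

    f⊥h : ∀ i j → ⟨ f (punchIn v i) , h (punchIn w j) ⟩ ≈ 0#
    f⊥h i j = decidable-stable (⟨ f (punchIn v i) , h (punchIn w j) ⟩ ≟ 0#) (λ ≉0 →
      -- An edge from a vertex of `G` to one of `H` other than `w` must start at `v`, which
      -- `punchIn v` avoids.
      Fin.punchInᵢ≢i v i (proj₁ (≡.subst₂ (GlueAdj G H v w) left right
        (Equivalence.from (represents distinct) ≉0))))
      where
      left : vertex w (punchIn v i ↑ˡ k) ≡ inj₁ (punchIn v i)
      left = vertex-↑ˡ (punchIn v i)
      right : vertex w (embed (punchIn w j)) ≡ inj₂ (punchIn w j)
      right = ≡.trans (vertex-embed (punchIn w j)) (image-other (λ e → Fin.punchInᵢ≢i w j (≡.sym e)))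
      distinct : punchIn v i ↑ˡ k ≢ embed (punchIn w j)
      distinct e with ≡.trans (≡.sym left) (≡.trans (≡.cong (vertex w) e) right)
      ... | ()

    e⊥e′ : ∀ a b → ⟨ e 𝓔 a , e 𝓕 b ⟩ ≈ 0#
    e⊥e′ a b = annihilated 𝓔 (e 𝓕 b) (λ i → orthogonal-sym {e 𝓕 b} {f (punchIn v i)}
      (annihilated 𝓕 (f (punchIn v i)) (λ j → orthogonal-sym {f (punchIn v i)} {h (punchIn w j)} (f⊥h i j)) b)) a

-- Ranges of dimensions

module _ (R : RealNumbers) (𝔽 : ScalarKind) where
  open Constructions (scalars R 𝔽) (scalars-isStarField R 𝔽) using (Rep; frame⇒rep; rep⇒frame; rep-order; rep-edge⇒0<; pad)
  open Composites (scalars R 𝔽) (scalars-isStarField R 𝔽)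

  module _ {n a : ℕ} (G : Graph n) (1≤n : 1 ≤ n) (just : IsJustFrameGraph R G a n) where

    lower≤order : a ≤ n
    lower≤order = proj₁ (Equivalence.to (just 𝔽 n 1≤n) (rep⇒frame G (rep-order G) ℕ.≤-refl))

    -- Up to the order a representation yields a frame; beyond the order `a ≤ n` already gives the
    -- bound.
    rep⇒lower≤ : ∀ {d} → 1 ≤ d → Rep d G → a ≤ d
    rep⇒lower≤ {d} 1≤d rep with ℕ.≤-total d n
    ... | inj₁ d≤n = proj₁ (Equivalence.to (just 𝔽 d 1≤d) (rep⇒frame G rep d≤n))
    ... | inj₂ n≤d = ℕ.≤-trans lower≤order n≤d

    rep-lower : 1 ≤ a → Rep a G
    rep-lower 1≤a = proj₁ (frame⇒rep G (Equivalence.from (just 𝔽 a 1≤a) (ℕ.≤-refl , lower≤order)))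

  module _ {n m n′ m′ : ℕ} (G : Graph n) (H : Graph m)
    (connG : Connected G) (connH : Connected H) (1<n : 1 < n) (1<m : 1 < m)
    (1≤n′ : 1 ≤ n′) (1≤m′ : 1 ≤ m′)
    (justG : IsJustFrameGraph R G n′ n) (justH : IsJustFrameGraph R H m′ m) where
    private
      1≤n : 1 ≤ n
      1≤n = ℕ.<⇒≤ 1<n
      1≤m : 1 ≤ m
      1≤m = ℕ.<⇒≤ 1<m

    join-dimensions : m′ ≤ n′ → ∀ d → 1 ≤ d →
      IsFrameGraphInDim (scalars R 𝔽) d (G ∨ H) ⇔ (n′ ≤ d × d ≤ m + n)
    join-dimensions m′≤n′ d 1≤d = mk⇔
      (λ frame → let rep , d≤n+m = frame⇒rep (G ∨ H) frame in
        rep⇒lower≤ G 1≤n justG 1≤d (rep-join⇒rep G H rep) , ≡.subst (d ≤_) (ℕ.+-comm n m) d≤n+m)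
      (λ (n′≤d , d≤m+n) → rep⇒frame (G ∨ H)
        -- `H` is first padded from dimension `m′` to `n′`, so that both graphs live in one space.
        (pad (G ∨ H) n′≤d (rep-join G H connG connH 1<n 1<m
          (rep-lower G 1≤n justG 1≤n′) (pad H m′≤n′ (rep-lower H 1≤m justH 1≤m′))))
        (≡.subst (d ≤_) (ℕ.+-comm m n) d≤m+n))

  module _ {n k n′ m′ : ℕ} (G : Graph (suc n)) (H : Graph (suc k))
    (connG : Connected G) (connH : Connected H) (1<n : 1 < suc n) (1<m : 1 < suc k)
    (1≤n′ : 1 ≤ n′) (1≤m′ : 1 ≤ m′)
    (justG : IsJustFrameGraph R G n′ (suc n)) (justH : IsJustFrameGraph R H m′ (suc k)) where

    glue-dimensions : ∀ v w d → 1 ≤ d →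
      IsFrameGraphInDim (scalars R 𝔽) d (glue G H v w) ⇔ (n′ + m′ ≤ d × d ≤ k + suc n)
    glue-dimensions v w d 1≤d = mk⇔
      (λ frame → let rep , d≤n+k = frame⇒rep (glue G H v w) frame
                     p , q , p+q≤d , repG , repH = rep-glue⇒reps G H v w rep in
        ℕ.≤-trans (ℕ.+-mono-≤
          (rep⇒lower≤ G (s≤s z≤n) justG (rep-edge⇒0< G repG (proj₂ (neighbour G connG 1<n v))) repG)
          (rep⇒lower≤ H (s≤s z≤n) justH (rep-edge⇒0< H repH (proj₂ (neighbour H connH 1<m w))) repH)) p+q≤d ,
        ≡.subst (d ≤_) (ℕ.+-comm (suc n) k) d≤n+k)
      (λ (n′+m′≤d , d≤k+n) → rep⇒frame (glue G H v w)
        (pad (glue G H v w) n′+m′≤d (rep-glue G H v w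
          (rep-lower G (s≤s z≤n) justG 1≤n′) (rep-lower H (s≤s z≤n) justH 1≤m′)))
        (≡.subst (d ≤_) (ℕ.+-comm k (suc n)) d≤k+n))

theorem3p4 : (R : RealNumbers) →
    ∀ {n m : ℕ} (G : Graph n) (H : Graph m) →
    Connected G → Connected H → 1 < n → 1 < m →
    (n′ m′ : ℕ) → 1 ≤ n′ → 1 ≤ m′ →
    IsJustFrameGraph R G n′ n →
    IsJustFrameGraph R H m′ m →
    n′ ≥ m′ →
    IsJustFrameGraph R (G ∨ H) n′ (m + n) ×
    (∀ (v : Fin n) (w : Fin m) →
    IsJustFrameGraph R (glue G H v w) (n′ + m′) (m + n ∸ 1))
-- Exposing the successors lets the upper end `m + n ∸ 1` reduce to the `k + suc n` of
-- `glue-dimensions`.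
theorem3p4 R {suc n} {suc m} G H connG connH 1<n 1<m n′ m′ 1≤n′ 1≤m′ justG justH n′≥m′ =
  (λ 𝔽 → join-dimensions R 𝔽 G H connG connH 1<n 1<m 1≤n′ 1≤m′ justG justH n′≥m′) ,
  (λ v w 𝔽 → glue-dimensions R 𝔽 G H connG connH 1<n 1<m 1≤n′ 1≤m′ justG justH v w)
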